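{- (a) There exists a hereditary $\{0,1\}_2$-property which is not weakly locally repairable. (b) There exists a hereditary undirected $(\mathrm{pt},\{0,1\},\{0,1\},\{0,1\})$-property which is not weakly locally repairable. (c) There exists a hereditary undirected $\{0,1\}_3$-property which is not weakly locally repairable.
   Context: A vertex set is a set that is at most countable; $\operatorname{Inj}(W,V)$ is the set of injections $W\to V$; $[j]=\{1,\dots,j\}$; $\binom{V}{j}$ the $j$-element subsets; $\uplus$ disjoint union, $\oplus$ direct sum of injections. A finite palette is a sequence $K=(K_j)_{j\ge0}$ of finite nonempty sets, all but finitely many singletons ($\mathrm{pt}$ denotes a singleton); its order is the largest $k$ with $|K_k|>1$. $\{0,1\}_k$ is the palette with $k$-th component $\{0,1\}$ and all others singletons; $(\mathrm{pt},\{0,1\},\{0,1\},\{0,1\})$ is the palette with $K_0$ a singleton, $K_1=K_2=K_3=\{0,1\}$ and $K_j$ singletons for $j>3$. A $K$-coloured hypergraph on $V$ is $G=(G_j)$, $G_j:\operatorname{Inj}([j],V)\to K_j$; $K^{(V)}$ is the set of these; $G$ is undirected if $G_j(\phi\circ\sigma)=G_j(\phi)$ for all $\sigma\in\operatorname{Inj}([j],[j])$. For $\phi\in\operatorname{Inj}(W,V)$, $K^{(\phi)}(G)_j(\psi)=G_j(\phi\circ\psi)$; $G\downharpoonright_W$ is pullback by inclusion. A hereditary $K$-property $\mathcal{P}$ assigns to each finite vertex set $V$ a set $\mathcal{P}^{(V)}\subset K^{(V)}$ with $K^{(\phi)}(\mathcal{P}^{(V)})\subset\mathcal{P}^{(W)}$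 for all injections $\phi:W\to V$ of finite sets; it is undirected if all its members are undirected. Local modification rule: $(A,T)$, $A$ a finite vertex set, maps $\overline{T}^{(V)}:K^{(A\uplus V)}\to K^{(V)}$ for every vertex set $V$ with $K^{(\phi)}\circ\overline{T}^{(V)}=\overline{T}^{(W)}\circ K^{(\mathrm{id}_A\oplus\phi)}$ for all $\phi\in\operatorname{Inj}(W,V)$. For finite $G\in K^{(V)}$ and $\phi\in\operatorname{Inj}(A,V)$, $T_\phi(G)=\overline{T}^{(V\setminus\phi(A))}(K^{(\phi\uplus\mathrm{id}_{V\setminus\phi(A)})}(G))\in K^{(V\setminus\phi(A))}$, where $\phi\uplus\mathrm{id}:A\uplus(V\setminus\phi(A))\to V$ is the induced bijection. With $k$ the order of $K$, $\mathcal{P}$ is weakly locally repairable if for every $\varepsilon>0$ there exist a finite set $A$, an integer $N\ge|A|+k$ and $\delta>0$ such that whenever $V$ is finite with $|V|\ge N$, $G\in K^{(V)}$, and at least a $1-\delta$ fraction of $W\in\binom{V}{N}$ satisfy $G\downharpoonright_W\in\mathcal{P}^{(W)}$, there exist a local modification rule $(A,T)$ and $\phi\in\operatorname{Inj}(A,V)$ such that $T_\phi(G)\in\mathcal{P}^{(V\setminus\phi(A))}$ and at most an $\varepsilon$ fraction of $W\in\binom{V\setminus\phi(A)}{k}$ satisfy $T_\phi(G)\downharpoonright_W\ne G\downharpoonright_W$. -}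

module Defs where

open import Data.Nat as ℕ using (ℕ; zero; suc; _≤_; _∸_; _≤?_)
open import Data.Nat.Combinatorics using (_C_)
open import Data.Fin as Fin using (Fin)
open import Data.Vec using (Vec; lookup; map; tabulate)
open import Data.Vec.Properties using (lookup-map)
open import Data.Sum using (_⊎_; inj₁; inj₂)
import Data.Sum as Sum
open import Data.Product using (Σ; ∃; ∃-syntax; _×_; _,_)
open import Data.Bool using (Bool; true; false; if_then_else_)
open import Data.List using (List; length)
open import Data.List.Relation.Unary.All using (All)
open import Data.List.Relation.Unary.Unique.Propositional using (Unique)
open import Data.Integer using (+_)
open import Data.Rational as ℚ using (ℚ; 0ℚ; 1ℚ)
open import Function using (_∘_; id; _⤖_)
open import Function.Bundles using (Bijection)
open import Function.Definitions using (Injective)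
open import Relation.Nullary using (¬_; does)
open import Relation.Binary.Definitions using (tri<; tri≈; tri>)
open import Data.Empty using (⊥-elim)
import Data.Fin.Properties as FinP
open import Relation.Binary.PropositionalEquality using (_≡_; refl; sym; trans; cong)

-- Finite palettes.  A finite nonempty set K_j is represented (up to
-- relabelling of colours) by Fin (card j).

record Palette : Set where
  field
    card     : ℕ → ℕ
    nonempty : ∀ j → 1 ≤ card j
    bound    : ℕ
    single   : ∀ j → bound ℕ.< j → card j ≡ 1

open Palette public

Col : Palette → ℕ → Set
Col K j = Fin (card K j)

orderUpTo : Palette → ℕ → ℕ
orderUpTo K zero    = zero
orderUpTo K (suc b) = if does (2 ≤? card K (suc b)) then suc b else orderUpTo K b

order : Palette → ℕ
order K = orderUpTo K (bound K)

-- Vertex sets.  Every at most countable set is in bijection with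
-- Fin n or with ℕ; these are the codes.

data VSet : Set where
  fin : ℕ → VSet
  inf : VSet

⟦_⟧ : VSet → Set
⟦ fin n ⟧ = Fin n
⟦ inf ⟧   = ℕ

-- K-coloured hypergraphs on a set X.  An injection [j] → X is an
-- injective j-tuple (a vector whose lookup is injective).

InjTuple : {X : Set} {j : ℕ} → Vec X j → Set
InjTuple v = Injective _≡_ _≡_ (lookup v)

record Hyp (K : Palette) (X : Set) : Set where
  constructor hyp
  field
    col : (j : ℕ) → (v : Vec X j) → .(InjTuple v) → Col K j

open Hyp public

_≈_ : {K : Palette} {X : Set} → Hyp K X → Hyp K X → Set
_≈_ {K} {X} G H = ∀ j (v : Vec X j) .(p : InjTuple v) → col G j v p ≡ col H j v p

map-inj : {X Y : Set} {j : ℕ} (f : Y → X) → Injective _≡_ _≡_ f →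
          (v : Vec Y j) → InjTuple v → InjTuple (map f v)
map-inj f finj v inj {i} {i'} eq =
  inj (finj (trans (sym (lookup-map i f v)) (trans eq (lookup-map i' f v))))

pull : {K : Palette} {X Y : Set} (f : Y → X) → .(Injective _≡_ _≡_ f) →
       Hyp K X → Hyp K Y
pull f finj G = hyp λ j v p → col G j (map f v) (map-inj f finj v p)

Undirected : {K : Palette} {X : Set} → Hyp K X → Set
Undirected {K} {X} G =
  ∀ j (v : Vec X j) .(p : InjTuple v) (σ : Fin j → Fin j) .(σinj : Injective _≡_ _≡_ σ) →
  col G j (tabulate (lookup v ∘ σ)) (λ {i} {i'} eq → σinj (p (perm-eq v σ i i' eq))) ≡ col G j v p
  where
  open import Data.Vec.Properties using (lookup∘tabulate)
  perm-eq : ∀ {j} (v : Vec X j) (σ : Fin j → Fin j) i i' →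
            lookup (tabulate (lookup v ∘ σ)) i ≡ lookup (tabulate (lookup v ∘ σ)) i' →
            lookup v (σ i) ≡ lookup v (σ i')
  perm-eq v σ i i' eq =
    trans (sym (lookup∘tabulate (lookup v ∘ σ) i)) (trans eq (lookup∘tabulate (lookup v ∘ σ) i'))

-- Hereditary K-properties (on finite vertex sets, represented by Fin n;
-- membership is a decidable, i.e. Bool-valued, predicate).

record Property (K : Palette) : Set₁ where
  field
    mem        : (n : ℕ) → Hyp K (Fin n) → Bool
    respects   : ∀ n {G H : Hyp K (Fin n)} → G ≈ H → mem n G ≡ mem n H
    hereditary : ∀ m n (φ : Fin m → Fin n) (φinj : Injective _≡_ _≡_ φ) (G : Hyp K (Fin n)) →
                 mem n G ≡ true → mem m (pull φ φinj G) ≡ true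

open Property public

UndirectedProperty : {K : Palette} → Property K → Set
UndirectedProperty {K} P = ∀ n (G : Hyp K (Fin n)) → mem P n G ≡ true → Undirected G

⊕-inj : {a : ℕ} {X Y : Set} (φ : Y → X) → Injective _≡_ _≡_ φ →
        Injective _≡_ _≡_ (Sum.map (id {A = Fin a}) φ)
⊕-inj φ φinj {inj₁ x} {inj₁ .x} refl = refl
⊕-inj φ φinj {inj₂ x} {inj₂ y} eq = cong inj₂ (φinj (inj₂-injective eq))
  where
  inj₂-injective : ∀ {A B : Set} {x y : B} → inj₂ {A = A} x ≡ inj₂ y → x ≡ y
  inj₂-injective refl = refl

record Rule (K : Palette) (a : ℕ) : Set where
  field
    T       : (V : VSet) → Hyp K (Fin a ⊎ ⟦ V ⟧) → Hyp K ⟦ V ⟧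
    resp    : ∀ V {G H : Hyp K (Fin a ⊎ ⟦ V ⟧)} → G ≈ H → T V G ≈ T V H
    natural : ∀ W V (φ : ⟦ W ⟧ → ⟦ V ⟧) (φinj : Injective _≡_ _≡_ φ)
                (G : Hyp K (Fin a ⊎ ⟦ V ⟧)) →
              pull φ φinj (T V G) ≈ T W (pull (Sum.map id φ) (⊕-inj φ φinj) G)

open Rule public

-- N-subsets of Fin n, represented by their strictly increasing
-- enumeration (a vector of length N).

StrictIncr : {n N : ℕ} → Vec (Fin n) N → Set
StrictIncr w = ∀ i i' → i Fin.< i' → lookup w i Fin.< lookup w i'

incr-inj : {n N : ℕ} (w : Vec (Fin n) N) → StrictIncr w → Injective _≡_ _≡_ (lookup w)
incr-inj w inc {i} {i'} eq with FinP.<-cmp i i'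
... | tri< lt _ _ = ⊥-elim (FinP.<-irrefl eq (inc i i' lt))
... | tri≈ _ e _  = e
... | tri> _ _ gt = ⊥-elim (FinP.<-irrefl (sym eq) (inc i' i gt))

restrict : {K : Palette} {n N : ℕ} → Hyp K (Fin n) →
           (w : Vec (Fin n) N) → StrictIncr w → Hyp K (Fin N)
restrict G w inc = pull (lookup w) (incr-inj w inc) G

⤖-to : {A B : Set} → A ⤖ B → A → B
⤖-to β = Bijection.to β

⤖-injective : {A B : Set} (β : A ⤖ B) → Injective _≡_ _≡_ (⤖-to β)
⤖-injective β = Bijection.injective β

ℕ→ℚ : ℕ → ℚ
ℕ→ℚ n = (+ n) ℚ./ 1

AtLeastFraction : (q : ℚ) (n N : ℕ) → ((w : Vec (Fin n) N) → StrictIncr w → Set) → Set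
AtLeastFraction q n N Q =
  Σ (List (Vec (Fin n) N)) λ ws →
    Unique ws ×
    All (λ w → Σ (StrictIncr w) (Q w)) ws ×
    (q ℚ.* ℕ→ℚ (n C N)) ℚ.≤ ℕ→ℚ (length ws)

WeaklyLocallyRepairable : {K : Palette} → Property K → Set
WeaklyLocallyRepairable {K} P =
  (ε : ℚ) → 0ℚ ℚ.< ε →
  Σ ℕ λ a → Σ ℕ λ N → Σ ℚ λ δ →
    (a ℕ.+ order K ≤ N) × (0ℚ ℚ.< δ) ×
    ((n : ℕ) → N ≤ n → (G : Hyp K (Fin n)) →
      AtLeastFraction (1ℚ ℚ.- δ) n N (λ w inc → mem P N (restrict G w inc) ≡ true) →
      Σ (Rule K a) λ R → Σ ℕ λ m → Σ ((Fin a ⊎ Fin m) ⤖ Fin n) λ β →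
        let G' : Hyp K (Fin a ⊎ Fin m)
            G' = pull (⤖-to β) (⤖-injective β) G
            -- T_φ(G) on V ∖ φ(A) ≅ Fin m, where φ = β ∘ inj₁
            TG : Hyp K (Fin m)
            TG = T R (fin m) G'
            Grest : Hyp K (Fin m)
            Grest = pull inj₂ inj₂-inj G'
        in (mem P m TG ≡ true) ×
           -- at most an ε fraction of k-subsets W change, i.e. at least
           -- a (1 - ε) fraction satisfy T_φ(G)↓W = G↓W
           AtLeastFraction (1ℚ ℚ.- ε) m (order K)
             (λ w inc → restrict TG w inc ≈ restrict Grest w inc))
  where
  inj₂-inj : ∀ {A B : Set} → Injective _≡_ _≡_ (inj₂ {A = A} {B = B})
  inj₂-inj refl = refl

-- {0,1}_k : k-th component {0,1} (= Fin 2), all others singletons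
cardAt : ℕ → ℕ → ℕ
cardAt zero    zero    = 2
cardAt zero    (suc _) = 1
cardAt (suc _) zero    = 1
cardAt (suc k) (suc j) = cardAt k j

cardAt-ne : ∀ k j → 1 ≤ cardAt k j
cardAt-ne zero    zero    = ℕ.s≤s ℕ.z≤n
cardAt-ne zero    (suc _) = ℕ.s≤s ℕ.z≤n
cardAt-ne (suc _) zero    = ℕ.s≤s ℕ.z≤n
cardAt-ne (suc k) (suc j) = cardAt-ne k j

cardAt-sg : ∀ k j → k ℕ.< j → cardAt k j ≡ 1
cardAt-sg zero    (suc j) _            = refl
cardAt-sg (suc k) (suc j) (ℕ.s≤s lt)   = cardAt-sg k j lt

binaryAt : ℕ → Palette
binaryAt k = record
  { card = cardAt k
  ; nonempty = cardAt-ne k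
  ; bound = k
  ; single = cardAt-sg k
  }

card123 : ℕ → ℕ
card123 0 = 1
card123 1 = 2
card123 2 = 2
card123 3 = 2
card123 (suc (suc (suc (suc _)))) = 1

pt0123 : Palette
pt0123 = record
  { card = card123
  ; nonempty = ne
  ; bound = 3
  ; single = sg
  }
  where
  ne : ∀ j → 1 ≤ card123 j
  ne 0 = ℕ.s≤s ℕ.z≤n
  ne 1 = ℕ.s≤s ℕ.z≤n
  ne 2 = ℕ.s≤s ℕ.z≤n
  ne 3 = ℕ.s≤s ℕ.z≤n
  ne (suc (suc (suc (suc _)))) = ℕ.s≤s ℕ.z≤n
  sg : ∀ j → 3 ℕ.< j → card123 j ≡ 1
  sg (suc (suc (suc (suc _)))) _ = refl
  sg 0 ()
  sg 1 (ℕ.s≤s ())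
  sg 2 (ℕ.s≤s (ℕ.s≤s ()))
  sg 3 (ℕ.s≤s (ℕ.s≤s (ℕ.s≤s ())))

{-# OPTIONS --safe #-}
-- A local rule commutes with every automorphism of G that fixes the image of A pointwise, so the
-- repaired structure inherits these automorphisms (LiftAutomorphism).  Each counterexample G
-- lives on many small blocks of vertices: on sets meeting every block at most once G has the
-- property, and most N-sets are of this kind, while inside the blocks G is too symmetric.
--
-- (a) The property is "tournament" and G orders the blocks linearly.  Some block of size two is
-- disjoint from A, and swapping its two vertices is an automorphism, impossible in a tournament.
--
-- (b), (c) Undirected structures on few vertices cannot be rigid, so the order of the blocks of V
-- is recorded by separators z ∈ Z: the edge {z, v, v′} has colour g z (min v v′), and the edges
-- {z, v, y} with y ∈ Y reveal g z v.  The property says that two separators never disagree on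
-- the order of v and v′.  An automorphism σ fixing A moves most z and v inside their blocks and
-- flips g z v, so in the repaired structure z and σ z disagree on the order of v and σ v, unless
-- one of the five edges zvy, zvy′, zyy′, z(σ v)y, z(σ v)y′ has been modified.  Counting the
-- quadruples (z, v, y, y′) shows that a fixed positive fraction of all triples is modified.

module Submission where

open import Defs
open import Data.Bool using (Bool; true; false; if_then_else_; not; _∧_; _xor_)
import Data.Bool.Properties as BoolP
open import Data.Empty using (⊥; ⊥-elim; ⊥-elim-irr)
open import Data.Fin as Fin using (Fin; zero; suc; combine; quotient; remainder; finToFun; funToFin; _↑ˡ_; _↑ʳ_)
open import Data.Fin.Patterns using (0F; 1F; 2F)
import Data.Fin.Permutation.Components as PC
import Data.Fin.Properties as FinP
open import Data.Integer as ℤ using (+_; -[1+_])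
import Data.Integer.Properties as ℤP
import Data.Integer.Tactic.RingSolver as ℤSolver
open import Data.List as List using (List; []; _∷_; _++_; length; cartesianProductWith; allFin)
open import Data.List.Membership.Propositional using (_∈_)
open import Data.List.Membership.Propositional.Properties using (∈-map⁻; ∈-cartesianProductWith⁻; ∈-lookup)
import Data.List.Properties as ListP
open import Data.List.Relation.Unary.All as All using (All; []; _∷_)
import Data.List.Relation.Unary.All.Properties as AllP
open import Data.List.Relation.Unary.AllPairs using ([]; _∷_)
open import Data.List.Relation.Unary.Unique.Propositional using (Unique)
import Data.List.Relation.Unary.Unique.Propositional.Properties as UniqueP
open import Data.Maybe using (Maybe; just; nothing)
import Data.Maybe.Properties as MaybeP
open import Data.Nat as ℕ using (ℕ; zero; suc; _+_; _*_; _∸_; _^_; _!; _≤_; _<_; z≤n; s≤s)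
open import Data.Nat.Combinatorics using (_C_; nCk+nC[k+1]≡[n+1]C[k+1])
open import Data.Nat.Properties hiding (_≟_)
open import Data.Nat.Tactic.RingSolver using (solve-∀)
open import Data.Product using (Σ; ∃; _×_; _,_; proj₁; proj₂)
import Data.Product.Properties as ProductP
open import Data.Rational as ℚ using (mkℚ; 0ℚ; 1ℚ)
import Data.Rational.Properties as ℚP
open import Data.Rational.Unnormalised as ℚᵘ using (mkℚᵘ; *≤*)
import Data.Rational.Unnormalised.Properties as ℚᵘP
open import Data.Sum as Sum using (_⊎_; inj₁; inj₂)
import Data.Sum.Properties as SumP
open import Data.Unit using (tt)
open import Data.Vec as Vec using (Vec; []; _∷_; lookup; zipWith)
import Data.Vec.Properties as VecP
open import Function using (_∘_; id; _⤖_; mk⇔; case_of_)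
open import Function.Bundles using (Bijection)
open import Function.Definitions using (Injective)
open import Relation.Binary.Definitions using (tri<; tri≈; tri>)
open import Relation.Binary.PropositionalEquality hiding (resp)
open import Relation.Nullary using (¬_; Dec; yes; no; does)
open import Relation.Nullary.Decidable using (decidable-stable; dec-false; dec-true; does-⇔; from-yes; ¬?; _×-dec_; _⊎-dec_; _→-dec_)
open import Algebra.Properties.CommutativeMonoid.Sum +-0-commutativeMonoid using (sum; sum-cong-≗; ∑-distrib-+; ∑-comm)
open import Algebra.Properties.Semiring.Sum +-*-semiring using (*-distribʳ-sum; *-distribˡ-sum)

-- Binomial coefficients and rational fractions

-- The quantifiers decide what may depend on what: `a`, `N` and δ are known before the structure is
-- built. The number of blocks makes `N`-sets mostly transversal, and in (b), (c) the number
-- `4 * suc a` of types leaves over three quarters of the types untouched by A. One bad block,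
-- enough in (a), is useless there, since a repair may recolour everything near it; the automorphism
-- must move a fixed proportion of Z and V while fixing A. If g z v were the sum of one bit of z and
-- one bit of v, a vertex of A in V would pin the bits of all of Z, and conversely. Hence every
-- vertex carries a separate bit for each type, and only bits between untouched types are flipped: g
-- is unchanged when both arguments move and negated when only v does. A palette with one nontrivial
-- level cannot colour the classes, so the property may not mention them; the second vertex y′ of Y
-- lets true edges alone identify the separator. The same property, read off level three, then
-- serves both palettes.

fall : ℕ → ℕ → ℕ
fall n       zero    = 1
fall zero    (suc k) = 0
fall (suc n) (suc k) = suc n * fall n k

-- Counts injective tuples by the place of one distinguished element: one of `suc k` positions, or
-- absent. It is Pascal's rule multiplied by a factorial.
fall-pascal : ∀ n k → fall (suc n) (suc k) ≡ suc k * fall n k + fall n (suc k)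
fall-pascal zero    zero    = refl
fall-pascal zero    (suc k) = sym (trans (+-identityʳ _) (*-zeroʳ k))
fall-pascal (suc n) zero    = 2+n n
  where
  2+n : ∀ n → suc (suc n) * 1 ≡ 1 * 1 + suc n * 1
  2+n = solve-∀
fall-pascal (suc n) (suc k) = begin
  suc (suc n) * X                                  ≡⟨⟩
  X + suc n * X                                    ≡⟨ cong (λ t → X + suc n * t) (fall-pascal n k) ⟩
  X + suc n * (suc k * fall n k + fall n (suc k))  ≡⟨ regroup n k (fall n k) (fall n (suc k)) ⟩
  suc (suc k) * X + suc n * fall n (suc k)         ∎
  where
  open ≡-Reasoning
  X = suc n * fall n k
  regroup : ∀ n k f g → suc n * f + suc n * (suc k * f + g) ≡ suc (suc k) * (suc n * f) + suc n * g
  regroup = solve-∀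

!*C≡fall : ∀ n k → k ! * (n C k) ≡ fall n k
!*C≡fall n       zero    = refl
!*C≡fall zero    (suc k) = *-zeroʳ (suc k !)
!*C≡fall (suc n) (suc k) = begin
  suc k ! * (suc n C suc k)                        ≡⟨ cong (suc k ! *_) (nCk+nC[k+1]≡[n+1]C[k+1] n k) ⟨
  suc k ! * (n C k + n C suc k)                    ≡⟨ regroup k (k !) (n C k) (n C suc k) ⟩
  suc k * (k ! * (n C k)) + suc k ! * (n C suc k)  ≡⟨ cong₂ (λ s t → suc k * s + t) (!*C≡fall n k) (!*C≡fall n (suc k)) ⟩
  suc k * fall n k + fall n (suc k)                ≡⟨ fall-pascal n k ⟨
  fall (suc n) (suc k)                             ∎
  where
  open ≡-Reasoning
  regroup : ∀ k f c d → suc k * f * (c + d) ≡ suc k * (f * c) + suc k * f * d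
  regroup = solve-∀

fall≤^ : ∀ n k → fall n k ≤ n ^ k
fall≤^ n       zero    = ≤-refl
fall≤^ zero    (suc k) = z≤n
fall≤^ (suc n) (suc k) = *-monoʳ-≤ (suc n) (≤-trans (fall≤^ n k) (^-monoˡ-≤ k (n≤1+n n)))

^≤fall : ∀ r k → r ^ k ≤ fall (k + r) k
^≤fall r zero    = ≤-refl
^≤fall r (suc k) = *-mono-≤ (m≤n+m r (suc k)) (^≤fall r k)

-- Bernoulli's inequality (1 - x)^k ≥ 1 - kx for x = c/(c + r), multiplied by (c + r)^(k + 1) so
-- that neither division nor subtraction occurs.
bernoulli : ∀ r c k → (c + r) * (c + r) ^ k ≤ (c + r) * r ^ k + k * c * (c + r) ^ k
bernoulli r c zero    = ≤-reflexive (sym (+-identityʳ _))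
bernoulli r c (suc k) = begin
  s * (s * s ^ k)                                  ≤⟨ *-monoʳ-≤ s (bernoulli r c k) ⟩
  s * (s * r ^ k + k * c * s ^ k)                  ≡⟨ regroup r c k (r ^ k) (s ^ k) ⟩
  s * (r * r ^ k) + (c * (s * r ^ k) + k * c * (s * s ^ k))
    ≤⟨ +-monoʳ-≤ (s * (r * r ^ k)) (+-monoˡ-≤ (k * c * (s * s ^ k)) (*-monoʳ-≤ c (*-monoʳ-≤ s (^-monoˡ-≤ k (m≤n+m r c))))) ⟩
  s * (r * r ^ k) + (c * (s * s ^ k) + k * c * (s * s ^ k))
    ≡⟨ cong (λ t → s * (r * r ^ k) + t) (*-distribʳ-+ (s * s ^ k) c (k * c)) ⟨
  s * (r * r ^ k) + suc k * c * (s * s ^ k)        ∎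
  where
  open ≤-Reasoning
  s = c + r
  regroup : ∀ r c k x y → (c + r) * ((c + r) * x + k * c * y)
            ≡ (c + r) * (r * x) + (c * ((c + r) * x) + k * c * ((c + r) * y))
  regroup = solve-∀

^-distribʳ-* : ∀ k x y → (x * y) ^ k ≡ x ^ k * y ^ k
^-distribʳ-* zero    x y = refl
^-distribʳ-* (suc k) x y rewrite ^-distribʳ-* k x y = swap x y (x ^ k) (y ^ k)
  where
  swap : ∀ x y u v → x * y * (u * v) ≡ x * u * (y * v)
  swap = solve-∀

-- After multiplication by N!, the left side is at most p (LB)^N, and `fall L N` is at least (L -
-- N)^N. By `bernoulli` the latter loses at most the factor 1 - N²/L ≥ p/(p + 1), whence the
-- quadratic bound on `L`.
transversal-ratio : ∀ p N L B → suc p * (N * N) ≤ L → 0 < L →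
  p * ((L * B) C N) ≤ suc p * ((L C N) * B ^ N)
transversal-ratio p N L@(suc _) B big _ = *-cancelˡ-≤ (N !) {{N !≢0}} (begin
  N ! * (p * ((L * B) C N))          ≡⟨ x∙yz (N !) p ((L * B) C N) ⟩
  p * (N ! * ((L * B) C N))          ≡⟨ cong (p *_) (!*C≡fall (L * B) N) ⟩
  p * fall (L * B) N                 ≤⟨ *-monoʳ-≤ p (fall≤^ (L * B) N) ⟩
  p * (L * B) ^ N                    ≡⟨ cong (p *_) (^-distribʳ-* N L B) ⟩
  p * (L ^ N * B ^ N)                ≡⟨ *-assoc p (L ^ N) (B ^ N) ⟨
  p * L ^ N * B ^ N                  ≤⟨ *-monoˡ-≤ (B ^ N) main ⟩
  suc p * fall L N * B ^ N           ≡⟨ cong (λ t → suc p * t * B ^ N) (!*C≡fall L N) ⟨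
  suc p * (N ! * (L C N)) * B ^ N    ≡⟨ regroup (suc p) (N !) (L C N) (B ^ N) ⟩
  N ! * (suc p * ((L C N) * B ^ N))  ∎)
  where
  open ≤-Reasoning
  open import Data.Nat.Base using (_∸_)
  x∙yz : ∀ x y z → x * (y * z) ≡ y * (x * z)
  x∙yz = solve-∀
  regroup : ∀ p f c b → p * (f * c) * b ≡ f * (p * (c * b))
  regroup = solve-∀
  r = L ∸ N
  N≤L : N ≤ L
  N≤L = ≤-trans (N≤N*N N) (≤-trans (m≤m+n (N * N) (p * (N * N))) big)
    where
    N≤N*N : ∀ N → N ≤ N * N
    N≤N*N zero    = z≤n
    N≤N*N (suc N) = m≤m*n (suc N) (suc N)
  N+r≡L : N + r ≡ L
  N+r≡L = m+[n∸m]≡n N≤L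
  expand : ∀ s l x y z → s * (l * x + y * z) ≡ l * (s * x) + s * y * z
  expand = solve-∀
  scaled : L * (suc p * L ^ N) ≤ L * (suc p * r ^ N + L ^ N)
  scaled = begin
    L * (suc p * L ^ N)                        ≡⟨ x∙yz L (suc p) (L ^ N) ⟩
    suc p * (L * L ^ N)                        ≤⟨ *-monoʳ-≤ (suc p) (subst (λ l → l * l ^ N ≤ l * r ^ N + N * N * l ^ N) N+r≡L (bernoulli r N N)) ⟩
    suc p * (L * r ^ N + N * N * L ^ N)        ≡⟨ expand (suc p) L (r ^ N) (N * N) (L ^ N) ⟩
    L * (suc p * r ^ N) + suc p * (N * N) * L ^ N ≤⟨ +-monoʳ-≤ (L * (suc p * r ^ N)) (*-monoˡ-≤ (L ^ N) big) ⟩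
    L * (suc p * r ^ N) + L * L ^ N            ≡⟨ *-distribˡ-+ L (suc p * r ^ N) (L ^ N) ⟨
    L * (suc p * r ^ N + L ^ N)                ∎
  main : p * L ^ N ≤ suc p * fall L N
  main = ≤-trans
    (+-cancelˡ-≤ (L ^ N) _ _ (subst (suc p * L ^ N ≤_) (+-comm (suc p * r ^ N) (L ^ N)) (*-cancelˡ-≤ L scaled)))
    (*-monoʳ-≤ (suc p) (subst (λ l → r ^ N ≤ fall l N) N+r≡L (^≤fall r N)))

toℚᵘ-ℕ→ℚ : ∀ n → ℚ.toℚᵘ (ℕ→ℚ n) ℚᵘ.≃ mkℚᵘ (+ n) 0
toℚᵘ-ℕ→ℚ n = ℚP.toℚᵘ-fromℚᵘ (mkℚᵘ (+ n) 0)

toℚᵘ-fraction : ∀ δ c → ℚ.toℚᵘ ((1ℚ ℚ.- δ) ℚ.* ℕ→ℚ c)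
  ℚᵘ.≃ (ℚᵘ.1ℚᵘ ℚᵘ.- ℚ.toℚᵘ δ) ℚᵘ.* mkℚᵘ (+ c) 0
toℚᵘ-fraction δ c = ℚᵘP.≃-trans (ℚP.toℚᵘ-homo-* (1ℚ ℚ.- δ) (ℕ→ℚ c))
  (ℚᵘP.*-cong
    (ℚᵘP.≃-trans (ℚP.toℚᵘ-homo-+ 1ℚ (ℚ.- δ)) (ℚᵘP.+-cong (ℚᵘP.≃-refl {ℚᵘ.1ℚᵘ}) (ℚP.toℚᵘ-homo‿- δ)))
    (toℚᵘ-ℕ→ℚ c))

-- The left side is what the numerator of (1 - (1 + u)/(1 + d)) · c unfolds to in unnormalised
-- rationals, with the cross factor 1 of the integer it is compared with.
numerator : ∀ d u c → (+ 1 ℤ.* (+ 1 ℤ.+ d) ℤ.+ ℤ.- (+ 1 ℤ.+ u) ℤ.* + 1) ℤ.* c ℤ.* + 1 ≡ d ℤ.* c ℤ.- u ℤ.* c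
numerator = ℤSolver.solve-∀

denominator : ∀ d l → + l ℤ.* + suc ((d + 0) * 1) ≡ + (suc d * l)
denominator d l = trans (sym (ℤP.pos-* l _)) (cong +_ (regroup d l))
  where
  regroup : ∀ d l → l * suc ((d + 0) * 1) ≡ suc d * l
  regroup = solve-∀

-- A positive δ with denominator d + 1 is at least 1/(d + 1), so 1 - δ ≤ d/(d + 1) and p = d works.
-- Together with `fraction-elim` it trades rational fractions for inequalities between naturals.
fraction-intro : ∀ δ → 0ℚ ℚ.< δ → Σ ℕ λ p → ∀ c l → p * c ≤ suc p * l → (1ℚ ℚ.- δ) ℚ.* ℕ→ℚ c ℚ.≤ ℕ→ℚ l
fraction-intro (mkℚ (+ zero) d _) (ℚ.*<* (ℤ.+<+ ()))
fraction-intro (mkℚ -[1+ _ ] d _) (ℚ.*<* ())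
fraction-intro δ@(mkℚ (+ suc u) d _) _ = d , λ c l dc≤ →
  ℚP.toℚᵘ-cancel-≤ (ℚᵘP.≤-trans (ℚᵘP.≤-reflexive (toℚᵘ-fraction δ c))
    (ℚᵘP.≤-trans (*≤* (numerators c l dc≤)) (ℚᵘP.≤-reflexive (ℚᵘP.≃-sym (toℚᵘ-ℕ→ℚ l)))))
  where
  numerators : ∀ c l → d * c ≤ suc d * l →
    (+ 1 ℤ.* + suc d ℤ.+ ℤ.- (+ suc u) ℤ.* + 1) ℤ.* + c ℤ.* + 1 ℤ.≤ + l ℤ.* + suc ((d + 0) * 1)
  numerators c l dc≤ = begin
    (+ 1 ℤ.* + suc d ℤ.+ ℤ.- (+ suc u) ℤ.* + 1) ℤ.* + c ℤ.* + 1  ≡⟨ numerator (+ d) (+ u) (+ c) ⟩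
    + d ℤ.* + c ℤ.- + u ℤ.* + c                                  ≡⟨ cong₂ ℤ._-_ (ℤP.pos-* d c) (ℤP.pos-* u c) ⟨
    + (d * c) ℤ.- + (u * c)                                      ≤⟨ ℤP.i-j≤i (+ (d * c)) (+ (u * c)) ⟩
    + (d * c)                                                    ≤⟨ ℤ.+≤+ dc≤ ⟩
    + (suc d * l)                                                ≡⟨ denominator d l ⟨
    + l ℤ.* + suc ((d + 0) * 1)                                  ∎
    where open ℤP.≤-Reasoning

fraction-elim : ∀ p c l → (1ℚ ℚ.- (+ 1 ℚ./ suc p)) ℚ.* ℕ→ℚ c ℚ.≤ ℕ→ℚ l → p * c ≤ suc p * l
fraction-elim p c l le with ℚᵘP.≤-trans (ℚᵘP.≤-reflexive (ℚᵘP.≃-sym (ℚᵘP.≃-trans (toℚᵘ-fraction (+ 1 ℚ./ suc p) c) eq))) (ℚᵘP.≤-trans (ℚP.toℚᵘ-mono-≤ le) (ℚᵘP.≤-reflexive (toℚᵘ-ℕ→ℚ l)))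
  where
  eq : (ℚᵘ.1ℚᵘ ℚᵘ.- ℚ.toℚᵘ (+ 1 ℚ./ suc p)) ℚᵘ.* mkℚᵘ (+ c) 0 ℚᵘ.≃ (ℚᵘ.1ℚᵘ ℚᵘ.- mkℚᵘ (+ 1) p) ℚᵘ.* mkℚᵘ (+ c) 0
  eq = ℚᵘP.*-cong (ℚᵘP.+-cong (ℚᵘP.≃-refl {ℚᵘ.1ℚᵘ}) (ℚᵘP.-‿cong (ℚP.toℚᵘ-fromℚᵘ (mkℚᵘ (+ 1) p)))) (ℚᵘP.≃-refl {mkℚᵘ (+ c) 0})
... | *≤* h = ℤP.drop‿+≤+ (subst₂ ℤ._≤_
  (trans (numerator (+ p) (+ 0) (+ c)) (trans (ℤP.+-identityʳ _) (sym (ℤP.pos-* p c)))) (denominator p l) h)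

-- Transversals of a partition into blocks

increasing : ∀ L N → List (Vec (Fin L) N)
increasing L       zero    = [] ∷ []
increasing zero    (suc N) = []
increasing (suc L) (suc N) =
  List.map (λ w → zero ∷ Vec.map suc w) (increasing L N) ++ List.map (Vec.map suc) (increasing L (suc N))

map-suc-injective : ∀ {L N} {v w : Vec (Fin L) N} → Vec.map Fin.suc v ≡ Vec.map Fin.suc w → v ≡ w
map-suc-injective {v = []}    {[]}    _  = refl
map-suc-injective {v = _ ∷ _} {_ ∷ _} eq =
  cong₂ _∷_ (FinP.suc-injective (VecP.∷-injectiveˡ eq)) (map-suc-injective (VecP.∷-injectiveʳ eq))

increasing-unique : ∀ L N → Unique (increasing L N)
increasing-unique L       zero    = [] ∷ []
increasing-unique zero    (suc N) = []
increasing-unique (suc L) (suc N) = UniqueP.++⁺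
  (UniqueP.map⁺ (map-suc-injective ∘ VecP.∷-injectiveʳ) (increasing-unique L N))
  (UniqueP.map⁺ map-suc-injective (increasing-unique L (suc N)))
  disjoint
  where
  disjoint : ∀ {w : Vec (Fin (suc L)) (suc N)} → w ∈ List.map (λ v → zero ∷ Vec.map suc v) (increasing L N)
                   × w ∈ List.map (Vec.map suc) (increasing L (suc N)) → ⊥
  disjoint (w∈₁ , w∈₂) with ∈-map⁻ _ w∈₁ | ∈-map⁻ _ w∈₂
  ... | _ , _ , refl | (_ ∷ _) , _ , ()

length-increasing : ∀ L N → length (increasing L N) ≡ L C N
length-increasing L       zero    = refl
length-increasing zero    (suc N) = refl
length-increasing (suc L) (suc N) = begin
  length (increasing (suc L) (suc N))                          ≡⟨ ListP.length-++ (List.map _ (increasing L N)) ⟩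
  length (List.map _ (increasing L N)) + length (List.map _ (increasing L (suc N)))
    ≡⟨ cong₂ _+_ (ListP.length-map _ (increasing L N)) (ListP.length-map _ (increasing L (suc N))) ⟩
  length (increasing L N) + length (increasing L (suc N))      ≡⟨ cong₂ _+_ (length-increasing L N) (length-increasing L (suc N)) ⟩
  L C N + L C suc N                                            ≡⟨ nCk+nC[k+1]≡[n+1]C[k+1] L N ⟩
  suc L C suc N                                                ∎
  where open ≡-Reasoning

map-suc-increasing : ∀ {L N} (w : Vec (Fin L) N) → StrictIncr w → StrictIncr (Vec.map suc w)
map-suc-increasing {L} w inc i j i<j
  rewrite VecP.lookup-map i (Fin.suc {n = L}) w | VecP.lookup-map j (Fin.suc {n = L}) w = s≤s (inc i j i<j)

increasing-strict : ∀ L N → All StrictIncr (increasing L N)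
increasing-strict L       zero    = (λ ()) ∷ []
increasing-strict zero    (suc N) = []
increasing-strict (suc L) (suc N) = AllP.++⁺
  (AllP.map⁺ (All.map (λ {w} → cons w) (increasing-strict L N)))
  (AllP.map⁺ (All.map (λ {w} → map-suc-increasing w) (increasing-strict L (suc N))))
  where
  cons : ∀ w → StrictIncr w → StrictIncr (zero ∷ Vec.map suc w)
  cons w inc zero    (suc j) _           rewrite VecP.lookup-map j (Fin.suc {n = L}) w = s≤s z≤n
  cons w inc (suc i) (suc j) (s≤s i<j) = map-suc-increasing w inc i j i<j

allVecs : ∀ B N → List (Vec (Fin B) N)
allVecs B zero    = [] ∷ []
allVecs B (suc N) = cartesianProductWith _∷_ (allFin B) (allVecs B N)

allVecs-unique : ∀ B N → Unique (allVecs B N)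
allVecs-unique B zero    = [] ∷ []
allVecs-unique B (suc N) =
  UniqueP.cartesianProductWith⁺ _∷_ VecP.∷-injective (UniqueP.allFin⁺ B) (allVecs-unique B N)

length-cartesianProductWith : ∀ {A B C : Set} (f : A → B → C) xs ys →
  length (cartesianProductWith f xs ys) ≡ length xs * length ys
length-cartesianProductWith f []       ys = refl
length-cartesianProductWith f (x ∷ xs) ys = trans (ListP.length-++ (List.map (f x) ys))
  (cong₂ _+_ (ListP.length-map (f x) ys) (length-cartesianProductWith f xs ys))

length-allVecs : ∀ B N → length (allVecs B N) ≡ B ^ N
length-allVecs B zero    = refl
length-allVecs B (suc N) = trans (length-cartesianProductWith _∷_ (allFin B) (allVecs B N))
  (cong₂ _*_ (ListP.length-tabulate {n = B} (λ i → i)) (length-allVecs B N))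

quotient-combine : ∀ {m n} (i : Fin m) (j : Fin n) → quotient {m} n (combine i j) ≡ i
quotient-combine i j = cong proj₁ (FinP.remQuot-combine i j)

module _ {L B : ℕ} where

  zip-combine : ∀ {N} → Vec (Fin L) N → Vec (Fin B) N → Vec (Fin (L * B)) N
  zip-combine = zipWith combine

  zip-combine-injective : ∀ {N} (bs cs : Vec (Fin L) N) (ps qs : Vec (Fin B) N) →
    zip-combine bs ps ≡ zip-combine cs qs → bs ≡ cs × ps ≡ qs
  zip-combine-injective []       []       []       []       _  = refl , refl
  zip-combine-injective (b ∷ bs) (c ∷ cs) (p ∷ ps) (q ∷ qs) eq
    with FinP.combine-injective b p c q (VecP.∷-injectiveˡ eq) | zip-combine-injective bs cs ps qs (VecP.∷-injectiveʳ eq)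
  ... | refl , refl | refl , refl = refl , refl

  Transversal : ∀ {N} → Vec (Fin (L * B)) N → Set
  Transversal w = ∀ {i j} → quotient {L} B (lookup w i) ≡ quotient {L} B (lookup w j) → i ≡ j

  -- A transversal set is a choice of blocks and of one position in each. Since `combine` is
  -- lexicographic with the block first, increasing blocks give increasing vertices.
  transversals : ∀ N → List (Vec (Fin (L * B)) N)
  transversals N = cartesianProductWith zip-combine (increasing L N) (allVecs B N)

  transversal-list : ∀ N → All (λ w → StrictIncr w × Transversal w) (transversals N)
  transversal-list N = All.tabulate λ w∈ → from (∈-cartesianProductWith⁻ zip-combine (increasing L N) (allVecs B N) w∈)
    where
    from : ∀ {w} → (∃ λ bs → ∃ λ ps → bs ∈ increasing L N × ps ∈ allVecs B N × w ≡ zip-combine bs ps) →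
           StrictIncr w × Transversal w
    from (bs , ps , bs∈ , _ , refl) = strict , transversal
      where
      inc : StrictIncr bs
      inc = All.lookup (increasing-strict L N) bs∈
      strict : StrictIncr (zip-combine bs ps)
      strict i j i<j rewrite VecP.lookup-zipWith combine i bs ps | VecP.lookup-zipWith combine j bs ps =
        FinP.combine-monoˡ-< (lookup ps i) (lookup ps j) (inc i j i<j)
      block : ∀ i → quotient {L} B (lookup (zip-combine bs ps) i) ≡ lookup bs i
      block i = trans (cong (quotient B) (VecP.lookup-zipWith combine i bs ps)) (quotient-combine _ _)
      transversal : Transversal (zip-combine bs ps)
      transversal {i} {j} eq = incr-inj bs inc (trans (sym (block i)) (trans eq (block j)))

  length-transversals : ∀ N → length (transversals N) ≡ (L C N) * B ^ N
  length-transversals N = trans (length-cartesianProductWith zip-combine (increasing L N) (allVecs B N))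
    (cong₂ _*_ (length-increasing L N) (length-allVecs B N))

-- `p` depends on δ alone, so `L` can be chosen once `N` is known, and the blocks may be as large as
-- a construction requires.
mostly-transversal : ∀ δ → 0ℚ ℚ.< δ → Σ ℕ λ p → ∀ N L B → suc p * (N * N) ≤ L → 0 < L →
  (Q : (w : Vec (Fin (L * B)) N) → StrictIncr w → Set) →
  (∀ w inc → Transversal {L} {B} w → Q w inc) →
  AtLeastFraction (1ℚ ℚ.- δ) (L * B) N Q
mostly-transversal δ 0<δ with fraction-intro δ 0<δ
... | p , intro = p , λ N L B big 0<L Q transversal⇒Q →
  transversals {L} {B} N ,
  UniqueP.cartesianProductWith⁺ (zip-combine {L} {B}) (zip-combine-injective _ _ _ _) (increasing-unique L N) (allVecs-unique B N) ,
  All.map (λ (inc , tr) → inc , transversal⇒Q _ inc tr) (transversal-list {L} {B} N) ,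
  intro ((L * B) C N) (length (transversals {L} {B} N))
    (subst (λ l → p * ((L * B) C N) ≤ suc p * l) (sym (length-transversals {L} {B} N)) (transversal-ratio p N L B big 0<L))

-- Automorphisms and local rules

col-cong : ∀ {K X j} (G : Hyp K X) {v w : Vec X j} .(p : InjTuple v) .(q : InjTuple w) →
           v ≡ w → col G j v p ≡ col G j w q
col-cong G p q refl = refl

does⇒true : ∀ {A : Set} (A? : Dec A) → does A? ≡ true → A
does⇒true (yes a) _ = a

module LiftAutomorphism
  {K : Palette} {a n m : ℕ} (R : Rule K a) (β : (Fin a ⊎ Fin m) ⤖ Fin n) (G : Hyp K (Fin n))
  (σ : Fin n → Fin n) (σinj : Injective _≡_ _≡_ σ) (σG≈G : pull σ σinj G ≈ G)
  (fixes : ∀ i → σ (⤖-to β (inj₁ i)) ≡ ⤖-to β (inj₁ i))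
  where

  private
    b : Fin a ⊎ Fin m → Fin n
    b = ⤖-to β
    b-injective : Injective _≡_ _≡_ b
    b-injective = ⤖-injective β
    TG : Hyp K (Fin m)
    TG = T R (fin m) (pull b b-injective G)

  -- If σ sent a vertex outside A to a vertex of A, which σ fixes, injectivity would put the first
  -- vertex into A as well.
  lift-spec : ∀ x → Σ (Fin m) λ y → b (inj₂ y) ≡ σ (b (inj₂ x))
  lift-spec x with Bijection.surjective β (σ (b (inj₂ x)))
  ... | inj₂ y , eq = y , eq refl
  ... | inj₁ i , eq with b-injective (σinj (trans (fixes i) (eq refl)))
  ... | ()

  lift : Fin m → Fin m
  lift = proj₁ ∘ lift-spec

  lift-σ : ∀ x → b (inj₂ (lift x)) ≡ σ (b (inj₂ x))
  lift-σ = proj₂ ∘ lift-spec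

  lift-unique : ∀ {x y} → b (inj₂ y) ≡ σ (b (inj₂ x)) → lift x ≡ y
  lift-unique eq = SumP.inj₂-injective (b-injective (trans (lift-σ _) (sym eq)))

  lift-injective : Injective _≡_ _≡_ lift
  lift-injective {x} {y} eq = SumP.inj₂-injective (b-injective (σinj
    (trans (sym (lift-σ x)) (trans (cong (b ∘ inj₂) eq) (lift-σ y)))))

  -- Naturality along `lift` moves the pullback inside the rule. There id ⊕ `lift` is σ seen through
  -- β, and it disappears because σ is an automorphism of `G`.
  T-invariant : pull lift lift-injective TG ≈ TG
  T-invariant j v p = trans
    (natural R (fin m) (fin m) lift lift-injective (pull b b-injective G) j v p)
    (resp R (fin m) same j v p)
    where
    commute : ∀ s → b (Sum.map id lift s) ≡ σ (b s)
    commute (inj₁ i) = sym (fixes i)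
    commute (inj₂ x) = lift-σ x
    same : pull (Sum.map id lift) (⊕-inj lift lift-injective) (pull b b-injective G) ≈ pull b b-injective G
    same j v p = trans
      (col-cong G
        (map-inj b b-injective (Vec.map (Sum.map id lift) v) (map-inj (Sum.map id lift) (⊕-inj lift lift-injective) v p))
        (map-inj σ σinj (Vec.map b v) (map-inj b b-injective v p))
        (trans (sym (VecP.map-∘ b (Sum.map id lift) v)) (trans (VecP.map-cong commute v) (VecP.map-∘ σ b v))))
      (σG≈G j (Vec.map b v) (map-inj b b-injective v p))

pair-injective : ∀ {X : Set} {x y : X} → x ≢ y → InjTuple (x ∷ y ∷ [])
pair-injective x≢y {zero}     {zero}     _  = refl
pair-injective x≢y {zero}     {suc zero} eq = ⊥-elim (x≢y eq)
pair-injective x≢y {suc zero} {zero}     eq = ⊥-elim (x≢y (sym eq))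
pair-injective x≢y {suc zero} {suc zero} _  = refl

-- Part (a): tournaments and ordered blocks

module Tournaments where

  K₂ : Palette
  K₂ = binaryAt 2

  Tournament : ∀ {n} → Hyp K₂ (Fin n) → Set
  Tournament G = ∀ x y → (x≢y : x ≢ y) →
    col G 2 (x ∷ y ∷ []) (pair-injective x≢y) ≢ col G 2 (y ∷ x ∷ []) (pair-injective (x≢y ∘ sym))

  tournament? : ∀ {n} (G : Hyp K₂ (Fin n)) → Dec (Tournament G)
  tournament? G = FinP.all? λ x → FinP.all? λ y → check x y
    where
    check : ∀ x y → Dec ((x≢y : x ≢ y) → col G 2 (x ∷ y ∷ []) (pair-injective x≢y) ≢ col G 2 (y ∷ x ∷ []) (pair-injective (x≢y ∘ sym)))
    check x y with x FinP.≟ y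
    ... | yes x≡y = yes λ x≢y → ⊥-elim (x≢y x≡y)
    -- Colours do not depend on the injectivity proof, so one comparison settles every proof of x ≢
    -- y.
    ... | no x≢y with col G 2 (x ∷ y ∷ []) (pair-injective x≢y) FinP.≟ col G 2 (y ∷ x ∷ []) (pair-injective (x≢y ∘ sym))
    ... | yes same = no λ f → f x≢y same
    ... | no diff  = yes λ _ → diff

  tournament-resp : ∀ {n} {G H : Hyp K₂ (Fin n)} → G ≈ H → Tournament G → Tournament H
  tournament-resp G≈H t x y x≢y eq = t x y x≢y
    (trans (G≈H 2 _ (pair-injective x≢y)) (trans eq (sym (G≈H 2 _ (pair-injective (x≢y ∘ sym))))))

  ≈-sym : ∀ {n} {G H : Hyp K₂ (Fin n)} → G ≈ H → H ≈ G
  ≈-sym G≈H j v p = sym (G≈H j v p)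

  tournaments : Property K₂
  tournaments = record
    { mem        = λ n G → does (tournament? G)
    ; respects   = λ n {G} {H} G≈H →
        does-⇔ (mk⇔ (tournament-resp G≈H) (tournament-resp (≈-sym {G = G} {H} G≈H))) (tournament? G) (tournament? H)
    ; hereditary = λ m n φ φinj G mem → dec-true (tournament? (pull φ φinj G))
        λ x y x≢y → does⇒true (tournament? G) mem (φ x) (φ y) (x≢y ∘ φinj)
    }

  module Orders (L B : ℕ) where

    block : Fin (L * B) → Fin L
    block = quotient B

    -- Inside a block both directions get colour zero, so every permutation preserving the blocks is
    -- an automorphism.
    arc : Fin (L * B) → Fin (L * B) → Fin 2
    arc x y = if does (block x Fin.<? block y) then suc zero else zero

    blockOrder : Hyp K₂ (Fin (L * B))
    blockOrder = hyp colour
      where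
      colour : (j : ℕ) (v : Vec (Fin (L * B)) j) → .(InjTuple v) → Col K₂ j
      colour 0 _ _ = zero
      colour 1 _ _ = zero
      colour 2 (x ∷ y ∷ []) _ = arc x y
      colour (suc (suc (suc j))) _ _ = zero

    arc-asym : ∀ x y → block x ≢ block y → arc x y ≢ arc y x
    arc-asym x y b≢ with FinP.<-cmp (block x) (block y)
    ... | tri< lt _ gt rewrite dec-true (block x Fin.<? block y) lt | dec-false (block y Fin.<? block x) gt = λ ()
    ... | tri≈ _ b≡ _ = ⊥-elim (b≢ b≡)
    ... | tri> lt _ gt rewrite dec-false (block x Fin.<? block y) lt | dec-true (block y Fin.<? block x) gt = λ ()

    transversal-tournament : ∀ {N} (w : Vec (Fin (L * B)) N) inc → Transversal {L} {B} w →
      mem tournaments N (restrict blockOrder w inc) ≡ true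
    transversal-tournament w inc tr = dec-true (tournament? (restrict blockOrder w inc))
      λ x y x≢y → arc-asym (lookup w x) (lookup w y) (x≢y ∘ tr)

    block-preserving : ∀ σ (σinj : Injective _≡_ _≡_ σ) → (∀ x → block (σ x) ≡ block x) →
      pull σ σinj blockOrder ≈ blockOrder
    block-preserving σ σinj pres 0 _ _ = refl
    block-preserving σ σinj pres 1 _ _ = refl
    block-preserving σ σinj pres 2 (x ∷ y ∷ []) _ =
      cong₂ (λ b c → if does (b Fin.<? c) then suc zero else zero) (pres x) (pres y)
    block-preserving σ σinj pres (suc (suc (suc j))) _ _ = refl

  missed : ∀ {a L} → a < L → (f : Fin a → Fin L) → Σ (Fin L) λ b → ∀ i → f i ≢ b
  missed a<L f with FinP.any? (λ b → FinP.all? λ i → ¬? (f i FinP.≟ b))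
  ... | yes (b , miss) = b , miss
  ... | no none = ⊥-elim (collide (FinP.pigeonhole a<L (proj₁ ∘ hit)))
    where
    hit : ∀ b → Σ _ λ i → f i ≡ b
    hit b with FinP.any? (λ i → f i FinP.≟ b)
    ... | yes h = h
    ... | no ¬h = ⊥-elim (none (b , λ i eq → ¬h (i , eq)))
    collide : ¬ (∃ λ b → ∃ λ c → b Fin.< c × proj₁ (hit b) ≡ proj₁ (hit c))
    collide (b , c , b<c , eq) = FinP.<-irrefl
      (trans (sym (proj₂ (hit b))) (trans (cong f eq) (proj₂ (hit c)))) b<c

  module Swap {L : ℕ} (c : Fin L) where

    p₀ p₁ : Fin (L * 2)
    p₀ = combine c zero
    p₁ = combine c (suc zero)

    swap : Fin (L * 2) → Fin (L * 2)
    swap = PC.transpose p₀ p₁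

    p₀≢p₁ : p₀ ≢ p₁
    p₀≢p₁ eq with FinP.combine-injectiveʳ c zero c (suc zero) eq
    ... | ()

    swap-injective : Injective _≡_ _≡_ swap
    swap-injective {x} {y} eq = trans (sym (PC.transpose-inverse p₁ p₀))
      (trans (cong (PC.transpose p₁ p₀) eq) (PC.transpose-inverse p₁ p₀))

    swap-p₀ : swap p₀ ≡ p₁
    swap-p₀ rewrite dec-true (p₀ FinP.≟ p₀) refl = refl

    swap-p₁ : swap p₁ ≡ p₀
    swap-p₁ rewrite dec-false (p₁ FinP.≟ p₀) (p₀≢p₁ ∘ sym) | dec-true (p₁ FinP.≟ p₁) refl = refl

    swap-block : ∀ x → quotient {L} 2 (swap x) ≡ quotient {L} 2 x
    swap-block x with x FinP.≟ p₀
    ... | yes eq = trans (quotient-combine c (suc zero)) (sym (trans (cong (quotient 2) eq) (quotient-combine {L} c zero)))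
    ... | no _ with x FinP.≟ p₁
    ...   | yes eq = trans (quotient-combine c zero) (sym (trans (cong (quotient 2) eq) (quotient-combine {L} c (suc zero))))
    ...   | no _   = refl

    swap-fixes : ∀ x → quotient {L} 2 x ≢ c → swap x ≡ x
    swap-fixes x ≢c with x FinP.≟ p₀
    ... | yes eq = ⊥-elim (≢c (trans (cong (quotient 2) eq) (quotient-combine c zero)))
    ... | no _ with x FinP.≟ p₁
    ...   | yes eq = ⊥-elim (≢c (trans (cong (quotient 2) eq) (quotient-combine c (suc zero))))
    ...   | no _   = refl

  module Unrepaired {a L m : ℕ} (a<L : a < L) (R : Rule K₂ a) (β : (Fin a ⊎ Fin m) ⤖ Fin (L * 2)) where

    open Orders L 2

    TG : Hyp K₂ (Fin m)
    TG = T R (fin m) (pull (⤖-to β) (⤖-injective β) blockOrder)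

    untouched : Σ (Fin L) λ c → ∀ i → block (⤖-to β (inj₁ i)) ≢ c
    untouched = missed a<L (λ i → block (⤖-to β (inj₁ i)))

    c : Fin L
    c = proj₁ untouched

    open Swap c

    open LiftAutomorphism R β blockOrder swap swap-injective
      (block-preserving swap swap-injective swap-block) (λ i → swap-fixes _ (proj₂ untouched i))

    outside : ∀ q → Σ (Fin m) λ x → ⤖-to β (inj₂ x) ≡ combine c q
    outside q with Bijection.surjective β (combine c q)
    ... | inj₁ i , eq = ⊥-elim (proj₂ untouched i (trans (cong block (eq refl)) (quotient-combine c q)))
    ... | inj₂ x , eq = x , eq refl

    x₀ x₁ : Fin m
    x₀ = proj₁ (outside zero)
    x₁ = proj₁ (outside (suc zero))

    β₀ : ⤖-to β (inj₂ x₀) ≡ p₀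
    β₀ = proj₂ (outside zero)

    β₁ : ⤖-to β (inj₂ x₁) ≡ p₁
    β₁ = proj₂ (outside (suc zero))

    x₀≢x₁ : x₀ ≢ x₁
    x₀≢x₁ eq = p₀≢p₁ (trans (sym β₀) (trans (cong (⤖-to β ∘ inj₂) eq) β₁))

    lift₀ : lift x₀ ≡ x₁
    lift₀ = lift-unique (trans β₁ (sym (trans (cong swap β₀) swap-p₀)))

    lift₁ : lift x₁ ≡ x₀
    lift₁ = lift-unique (trans β₀ (sym (trans (cong swap β₁) swap-p₁)))

    symmetric : col TG 2 (x₀ ∷ x₁ ∷ []) (pair-injective x₀≢x₁) ≡ col TG 2 (x₁ ∷ x₀ ∷ []) (pair-injective (x₀≢x₁ ∘ sym))
    symmetric = trans (sym (T-invariant 2 (x₀ ∷ x₁ ∷ []) (pair-injective x₀≢x₁)))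
      (col-cong TG _ _ (cong₂ (λ u v → u ∷ v ∷ []) lift₀ lift₁))

    TG∉P : mem tournaments m TG ≢ true
    TG∉P TG∈P = does⇒true (tournament? TG) TG∈P x₀ x₁ x₀≢x₁ symmetric

  not-repairable : ¬ WeaklyLocallyRepairable tournaments
  not-repairable repair =
    -- ε = 1 is enough: the contradiction comes from membership of the repaired structure, however
    -- many pairs were changed.
    let a , N , δ , a+2≤N , 0<δ , fix = repair 1ℚ (ℚP.positive⁻¹ 1ℚ)
        p , most = mostly-transversal δ 0<δ
        -- The least number of blocks that `most` accepts. It exceeds `a` because a + 2 ≤ N ≤ N².
        L = suc p * (N * N)
        N≤L = ≤-trans (m≤m*n N N {{ℕ.>-nonZero (≤-trans (s≤s z≤n) (≤-trans (m≤n+m 2 a) a+2≤N))}})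
                      (m≤m+n (N * N) (p * (N * N)))
        a<L = ≤-trans (m<m+n a (s≤s z≤n)) (≤-trans a+2≤N N≤L)
        R , m , β , TG∈P , _ = fix (L * 2) (≤-trans N≤L (m≤m*n L 2)) (Orders.blockOrder L 2)
          (most N L 2 ≤-refl (≤-trans (s≤s z≤n) a<L) _ (λ w inc tr → Orders.transversal-tournament L 2 w inc tr))
    in Unrepaired.TG∉P a<L R β TG∈P

-- Finite sums

∑-mono : ∀ {n} {f g : Fin n → ℕ} → (∀ i → f i ≤ g i) → sum f ≤ sum g
∑-mono {zero}  f≤g = z≤n
∑-mono {suc n} f≤g = +-mono-≤ (f≤g zero) (∑-mono (f≤g ∘ suc))

∑-const : ∀ n c → sum {n} (λ _ → c) ≡ n * c
∑-const zero    c = refl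
∑-const (suc n) c = cong (c ℕ.+_) (∑-const n c)

∑-split : ∀ m {n} (f : Fin (m + n) → ℕ) → sum f ≡ sum (f ∘ (_↑ˡ n)) + sum (f ∘ (m ↑ʳ_))
∑-split zero    f = refl
∑-split (suc m) f = trans (cong (f zero ℕ.+_) (∑-split m (f ∘ suc))) (sym (+-assoc (f zero) _ _))

∑-combine : ∀ {m n} (f : Fin (m * n) → ℕ) → sum f ≡ sum {m} (λ i → sum {n} (λ j → f (combine i j)))
∑-combine {zero}      f = refl
∑-combine {suc m} {n} f = trans (∑-split n f) (cong (sum (f ∘ (_↑ˡ m * n)) ℕ.+_) (∑-combine {m} (f ∘ (n ↑ʳ_))))

𝟙 : ∀ {A : Set} → Dec A → ℕ
𝟙 A? = if does A? then 1 else 0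

𝟙-yes : ∀ {A : Set} (A? : Dec A) → A → 𝟙 A? ≡ 1
𝟙-yes A? a rewrite dec-true A? a = refl

𝟙-no : ∀ {A : Set} (A? : Dec A) → ¬ A → 𝟙 A? ≡ 0
𝟙-no A? ¬a rewrite dec-false A? ¬a = refl

𝟙≤1 : ∀ {A : Set} (A? : Dec A) → 𝟙 A? ≤ 1
𝟙≤1 (yes _) = s≤s z≤n
𝟙≤1 (no _)  = z≤n

∑-zero : ∀ {n} {f : Fin n → ℕ} → (∀ i → f i ≡ 0) → sum f ≡ 0
∑-zero {n} f≡0 = trans (sum-cong-≗ f≡0) (trans (∑-const n 0) (*-zeroʳ n))

∑-point : ∀ {n} (i : Fin n) (g : Fin n → ℕ) → sum (λ j → 𝟙 (i FinP.≟ j) * g j) ≡ g i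
∑-point zero    g = trans (cong₂ _+_ (+-identityʳ (g zero)) (∑-zero {f = λ j → 0 * g (suc j)} λ _ → refl)) (+-identityʳ (g zero))
∑-point (suc i) g = ∑-point i (g ∘ suc)

fibre≤1 : ∀ {p q} (f : Fin p → Fin q) → Injective _≡_ _≡_ f → ∀ j → sum (λ i → 𝟙 (f i FinP.≟ j)) ≤ 1
fibre≤1 {zero}  f inj j = z≤n
fibre≤1 {suc p} f inj j with f zero FinP.≟ j
... | no _     = fibre≤1 (f ∘ suc) (FinP.suc-injective ∘ inj) j
... | yes refl = ≤-reflexive (cong suc (∑-zero λ i → 𝟙-no (f (suc i) FinP.≟ f zero) λ eq → FinP.0≢1+n (sym (inj eq))))

-- Writing g (f i) as a sum of Kronecker deltas and exchanging the sums weights each g j by the size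
-- of its fibre, which is at most one.
∑-injective : ∀ {p q} (f : Fin p → Fin q) → Injective _≡_ _≡_ f → (g : Fin q → ℕ) → sum (g ∘ f) ≤ sum g
∑-injective f inj g = begin
  sum (g ∘ f)                                       ≡⟨ sum-cong-≗ (λ i → sym (∑-point (f i) g)) ⟩
  sum (λ i → sum (λ j → 𝟙 (f i FinP.≟ j) * g j))    ≡⟨ ∑-comm (λ i j → 𝟙 (f i FinP.≟ j) * g j) ⟩
  sum (λ j → sum (λ i → 𝟙 (f i FinP.≟ j) * g j))    ≡⟨ sum-cong-≗ (λ j → sym (*-distribʳ-sum (g j) (λ i → 𝟙 (f i FinP.≟ j)))) ⟩
  sum (λ j → sum (λ i → 𝟙 (f i FinP.≟ j)) * g j)    ≤⟨ ∑-mono (λ j → *-monoˡ-≤ (g j) (fibre≤1 f inj j)) ⟩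
  sum (λ j → 1 * g j)                               ≡⟨ sum-cong-≗ (λ j → *-identityˡ (g j)) ⟩
  sum g                                             ∎
  where open ≤-Reasoning

-- The complement 1 - g equals one on the image of `f`, so its sum is at least `p`; the sums of g
-- and 1 - g add up to `q`.
∑+zeros : ∀ {p q} (f : Fin p → Fin q) → Injective _≡_ _≡_ f → (g : Fin q → ℕ) →
  (∀ j → g j ≤ 1) → (∀ i → g (f i) ≡ 0) → sum g + p ≤ q
∑+zeros {p} {q} f inj g g≤1 g∘f≡0 = begin
  sum g + p                                ≡⟨ cong (sum g ℕ.+_) (trans (∑-const p 1) (*-identityʳ p)) ⟨
  sum g + sum {p} (λ _ → 1)                ≡⟨ cong (sum g ℕ.+_) (sum-cong-≗ (λ i → cong (1 ∸_) (sym (g∘f≡0 i)))) ⟩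
  sum g + sum (λ i → 1 ∸ g (f i))          ≤⟨ +-monoʳ-≤ (sum g) (∑-injective f inj (λ j → 1 ∸ g j)) ⟩
  sum g + sum (λ j → 1 ∸ g j)              ≡⟨ ∑-distrib-+ g (λ j → 1 ∸ g j) ⟨
  sum (λ j → g j + (1 ∸ g j))              ≡⟨ sum-cong-≗ (λ j → m+[n∸m]≡n (g≤1 j)) ⟩
  sum {q} (λ _ → 1)                        ≡⟨ trans (∑-const q 1) (*-identityʳ q) ⟩
  q                                        ∎
  where open ≤-Reasoning

-- A value that is hit is counted at least once among its preimages, and each i lies over exactly
-- one value.
∑-image : ∀ {a D} (f : Fin a → Fin D) → sum (λ l → 𝟙 (FinP.any? (λ i → f i FinP.≟ l))) ≤ a
∑-image {a} {D} f = begin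
  sum (λ l → 𝟙 (FinP.any? (λ i → f i FinP.≟ l)))        ≤⟨ ∑-mono hit ⟩
  sum (λ l → sum (λ i → 𝟙 (f i FinP.≟ l)))              ≡⟨ ∑-comm (λ l i → 𝟙 (f i FinP.≟ l)) ⟩
  sum (λ i → sum (λ l → 𝟙 (f i FinP.≟ l)))              ≡⟨ sum-cong-≗ one ⟩
  sum {a} (λ _ → 1)                                     ≡⟨ trans (∑-const a 1) (*-identityʳ a) ⟩
  a                                                     ∎
  where
  open ≤-Reasoning
  one : ∀ i → sum (λ l → 𝟙 (f i FinP.≟ l)) ≡ 1
  one i = trans (sum-cong-≗ (λ l → sym (*-identityʳ (𝟙 (f i FinP.≟ l))))) (∑-point (f i) (λ _ → 1))
  term≤∑ : ∀ {n} (g : Fin n → ℕ) i → g i ≤ sum g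
  term≤∑ g zero    = m≤m+n (g zero) _
  term≤∑ g (suc i) = ≤-trans (term≤∑ (g ∘ suc) i) (m≤n+m _ (g zero))
  hit : ∀ l → 𝟙 (FinP.any? (λ i → f i FinP.≟ l)) ≤ sum (λ i → 𝟙 (f i FinP.≟ l))
  hit l with FinP.any? (λ i → f i FinP.≟ l)
  ... | no _         = z≤n
  ... | yes (i , eq) = ≤-trans (≤-reflexive (sym (𝟙-yes (f i FinP.≟ l) eq))) (term≤∑ (λ i → 𝟙 (f i FinP.≟ l)) i)

-- Blocks, classes, types and bits

remQuot-injective : ∀ {m} n {i j : Fin (m * n)} →
  quotient {m} n i ≡ quotient {m} n j → remainder {m} n i ≡ remainder {m} n j → i ≡ j
remQuot-injective {m} n {i} {j} q≡ r≡ =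
  trans (sym (FinP.combine-remQuot {m} n i)) (trans (cong₂ combine q≡ r≡) (FinP.combine-remQuot {m} n j))

remainder-combine : ∀ {m n} (i : Fin m) (j : Fin n) → remainder {m} n (combine i j) ≡ j
remainder-combine i j = cong proj₂ (FinP.remQuot-combine i j)

toBool : Fin 2 → Bool
toBool zero    = false
toBool (suc _) = true

fromBool : Bool → Fin 2
fromBool false = zero
fromBool true  = suc zero

toBool-fromBool : ∀ b → toBool (fromBool b) ≡ b
toBool-fromBool false = refl
toBool-fromBool true  = refl

toBool-injective : ∀ {i j} → toBool i ≡ toBool j → i ≡ j
toBool-injective {zero}     {zero}     _ = refl
toBool-injective {suc zero} {suc zero} _ = refl

funToFin-cong : ∀ {m n} {f g : Fin m → Fin n} → f ≗ g → funToFin f ≡ funToFin g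
funToFin-cong {zero}  f≗g = refl
funToFin-cong {suc m} f≗g = cong₂ combine (f≗g zero) (funToFin-cong (f≗g ∘ suc))

decode : ∀ {D} → Fin (2 ^ D) → Fin D → Bool
decode s j = toBool (finToFun s j)

encode : ∀ {D} → (Fin D → Bool) → Fin (2 ^ D)
encode s = funToFin (fromBool ∘ s)

decode-encode : ∀ {D} (s : Fin D → Bool) → decode (encode s) ≗ s
decode-encode s j = trans (cong toBool (FinP.finToFun-funToFin (fromBool ∘ s) j)) (toBool-fromBool (s j))

decode-injective : ∀ {D} {s t : Fin (2 ^ D)} → decode s ≗ decode t → s ≡ t
decode-injective {D} {s} {t} eq = trans (sym (FinP.funToFin-finToFin {D} s))
  (trans (funToFin-cong {D} {2} {finToFun s} {finToFun t} (toBool-injective ∘ eq)) (FinP.funToFin-finToFin {D} t))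

-- A vertex is a block, a class (Z, V or Y), a type in Fin D and a vector of D bits;
-- member c enumerates the q vertices of class c.
record Coding (L D n q : ℕ) : Set where
  field
    blk  : Fin n → Fin L
    cls  : Fin n → Fin 3
    typ  : Fin n → Fin D
    bits : Fin n → Fin D → Bool
    ext  : ∀ {x y} → blk x ≡ blk y → cls x ≡ cls y → typ x ≡ typ y → bits x ≗ bits y → x ≡ y
    mk      : Fin L → Fin 3 → Fin D → (Fin D → Bool) → Fin n
    blk-mk  : ∀ b c k s → blk (mk b c k s) ≡ b
    cls-mk  : ∀ b c k s → cls (mk b c k s) ≡ c
    typ-mk  : ∀ b c k s → typ (mk b c k s) ≡ k
    bits-mk : ∀ b c k s → bits (mk b c k s) ≗ s
    member           : Fin 3 → Fin q → Fin n
    member-injective : ∀ c → Injective _≡_ _≡_ (member c)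
    cls-member       : ∀ c i → cls (member c i) ≡ c
    typ-equidistributed : ∀ c (f : Fin D → ℕ) → D * sum (λ i → f (typ (member c i))) ≡ q * sum f

module _ (L D : ℕ) where

  private
    Rest n q : ℕ
    Rest = D * 2 ^ D
    n = L * (3 * Rest)
    q = L * Rest

    pos : Fin n → Fin (3 * Rest)
    pos = remainder {L} (3 * Rest)

    rest : Fin n → Fin Rest
    rest x = remainder {3} Rest (pos x)

    vertex : Fin L → Fin 3 → Fin Rest → Fin n
    vertex b c r = combine b (combine c r)

    pos-vertex : ∀ b c r → pos (vertex b c r) ≡ combine c r
    pos-vertex b c r = remainder-combine b (combine c r)

    rest-vertex : ∀ b c r → rest (vertex b c r) ≡ r
    rest-vertex b c r = trans (cong (remainder {3} Rest) (pos-vertex b c r)) (remainder-combine c r)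

    cls-vertex : ∀ b c r → quotient {3} Rest (pos (vertex b c r)) ≡ c
    cls-vertex b c r = trans (cong (quotient {3} Rest) (pos-vertex b c r)) (quotient-combine c r)

    member : Fin 3 → Fin q → Fin n
    member c i = vertex (quotient {L} Rest i) c (remainder {L} Rest i)

    -- Each of the D types occurs L · 2^D times in a class, which has q = L · D · 2^D vertices. The
    -- factors `D` and `q` state the equality of averages without division.
    ∑-typ : ∀ c (f : Fin D → ℕ) → D * sum (λ i → f (quotient {D} (2 ^ D) (rest (member c i)))) ≡ q * sum f
    ∑-typ c f = begin
      D * sum (λ i → f (quotient {D} (2 ^ D) (rest (member c i))))
        ≡⟨ cong (D *_) (sum-cong-≗ (λ i → cong (f ∘ quotient {D} (2 ^ D)) (rest-vertex _ c (remainder {L} Rest i)))) ⟩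
      D * sum (λ i → f (quotient {D} (2 ^ D) (remainder {L} Rest i)))
        ≡⟨ cong (D *_) (∑-combine {L} (λ i → f (quotient {D} (2 ^ D) (remainder {L} Rest i)))) ⟩
      D * sum {L} (λ b → sum {Rest} (λ r → f (quotient {D} (2 ^ D) (remainder {L} Rest (combine b r)))))
        ≡⟨ cong (D *_) (sum-cong-≗ {L} (λ b → sum-cong-≗ {Rest} (λ r → cong (f ∘ quotient {D} (2 ^ D)) (remainder-combine b r)))) ⟩
      D * sum {L} (λ _ → sum {Rest} (λ r → f (quotient {D} (2 ^ D) r)))
        ≡⟨ cong (D *_) (∑-const L _) ⟩
      D * (L * sum {Rest} (λ r → f (quotient {D} (2 ^ D) r)))
        ≡⟨ cong (λ t → D * (L * t)) (∑-combine {D} (λ r → f (quotient {D} (2 ^ D) r))) ⟩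
      D * (L * sum {D} (λ k → sum {2 ^ D} (λ s → f (quotient {D} (2 ^ D) (combine k s)))))
        ≡⟨ cong (λ t → D * (L * t)) (sum-cong-≗ {D} (λ k → sum-cong-≗ {2 ^ D} (λ s → cong f (quotient-combine {D} {2 ^ D} k s)))) ⟩
      D * (L * sum {D} (λ k → sum {2 ^ D} (λ _ → f k)))
        ≡⟨ cong (λ t → D * (L * t)) (sum-cong-≗ {D} (λ k → ∑-const (2 ^ D) (f k))) ⟩
      D * (L * sum {D} (λ k → 2 ^ D * f k))
        ≡⟨ cong (λ t → D * (L * t)) (sym (*-distribˡ-sum (2 ^ D) f)) ⟩
      D * (L * (2 ^ D * sum f))
        ≡⟨ regroup D L (2 ^ D) (sum f) ⟩
      q * sum f ∎
      where
      open ≡-Reasoning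
      regroup : ∀ d l e f → d * (l * (e * f)) ≡ l * (d * e) * f
      regroup = solve-∀

  coding : Coding L D n q
  coding = record
    { blk  = quotient (3 * Rest)
    ; cls  = λ x → quotient {3} Rest (pos x)
    ; typ  = λ x → quotient {D} (2 ^ D) (rest x)
    ; bits = λ x → decode {D} (remainder {D} (2 ^ D) (rest x))
    ; ext  = λ b≡ c≡ t≡ s≡ → remQuot-injective {L} (3 * Rest) b≡
        (remQuot-injective {3} Rest c≡ (remQuot-injective {D} (2 ^ D) t≡ (decode-injective {D} s≡)))
    ; mk      = λ b c k s → vertex b c (combine k (encode s))
    ; blk-mk  = λ b c k s → quotient-combine b (combine c (combine k (encode s)))
    ; cls-mk  = λ b c k s → cls-vertex b c (combine k (encode s))
    ; typ-mk  = λ b c k s → trans (cong (quotient {D} (2 ^ D)) (rest-vertex b c _)) (quotient-combine k (encode s))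
    ; bits-mk = λ b c k s j → trans
        (cong (λ t → decode {D} t j)
          (trans (cong (remainder {D} (2 ^ D)) (rest-vertex b c _)) (remainder-combine k (encode s))))
        (decode-encode s j)
    ; member           = member
    ; member-injective = λ c {i} {j} eq → remQuot-injective {L} Rest
        (FinP.combine-injectiveˡ (quotient {L} Rest i) (combine c (remainder {L} Rest i)) (quotient {L} Rest j) (combine c (remainder {L} Rest j)) eq)
        (trans (sym (rest-vertex _ c _)) (trans (cong rest eq) (rest-vertex _ c _)))
    ; cls-member          = λ c i → cls-vertex _ c _
    ; typ-equidistributed = ∑-typ
    }

-- The undirected structure with separators

pattern Z = zero
pattern V = suc zero
pattern Y = suc (suc zero)

module Graph {L D n q : ℕ} (𝓒 : Coding L D n q) where

  open Coding 𝓒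

  -- The class is the leading digit, so each vertex of V precedes each vertex of Y whatever their
  -- blocks. An edge {z, v, y} therefore reads g z v.
  rank : Fin n → Fin (3 * L)
  rank x = combine (cls x) (blk x)

  -- g is dense, yet a vertex sees only the bit of the others indexed by its own type.
  -- Hence few vertices leave most bits unseen, and flipping these is undetectable (module Flip).
  value : Fin 3 → Bool → Bool
  value Y b = true
  value _ b = b

  g : Fin n → Fin n → Bool
  g z x = value (cls x) (bits z (typ x) xor bits x (typ z))

  -- F z x y reads g z at the earlier of x and y.  On distinct blocks this exposes the order of
  -- x and y to any z separating them; within one block it is a constant and exposes nothing.
  F : Fin n → Fin n → Fin n → Bool
  F z x y = if does (rank x Fin.<? rank y) then g z x else
            if does (rank y Fin.<? rank x) then g z y else true

  F-< : ∀ z x y → rank x Fin.< rank y → F z x y ≡ g z x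
  F-< z x y lt rewrite dec-true (rank x Fin.<? rank y) lt = refl

  F-> : ∀ z x y → rank y Fin.< rank x → F z x y ≡ g z y
  F-> z x y lt
    rewrite dec-false (rank x Fin.<? rank y) (FinP.<-asym lt) | dec-true (rank y Fin.<? rank x) lt = refl

  F-≡ : ∀ z x y → rank x ≡ rank y → F z x y ≡ true
  F-≡ z x y eq
    rewrite dec-false (rank x Fin.<? rank y) (FinP.<-irrefl eq)
          | dec-false (rank y Fin.<? rank x) (FinP.<-irrefl (sym eq)) = refl

  F-sym : ∀ z x y → F z x y ≡ F z y x
  F-sym z x y with FinP.<-cmp (rank x) (rank y)
  ... | tri< lt _ _ = trans (F-< z x y lt) (sym (F-> z y x lt))
  ... | tri≈ _ eq _ = trans (F-≡ z x y eq) (sym (F-≡ z y x (sym eq)))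
  ... | tri> _ _ gt = trans (F-> z x y gt) (sym (F-< z y x gt))

  isZ : Fin 3 → Bool
  isZ Z = true
  isZ _ = false

  pick : (a b c p q r : Bool) → Bool
  pick true  false false p q r = p
  pick false true  false p q r = q
  pick false false true  p q r = r
  pick _     _     _     p q r = false

  -- The vertex of Z, in whichever position it stands, takes the role of z in `F`; this makes `h`
  -- symmetric.
  h : Fin n → Fin n → Fin n → Bool
  h x y w = pick (isZ (cls x)) (isZ (cls y)) (isZ (cls w)) (F x y w) (F y x w) (F w x y)

  h-swap₁₂ : ∀ x y w → h x y w ≡ h y x w
  h-swap₁₂ x y w with isZ (cls x) | isZ (cls y) | isZ (cls w)
  ... | true  | true  | true  = refl
  ... | true  | true  | false = refl
  ... | true  | false | true  = refl
  ... | true  | false | false = refl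
  ... | false | true  | true  = refl
  ... | false | true  | false = refl
  ... | false | false | true  = F-sym w x y
  ... | false | false | false = refl

  h-swap₂₃ : ∀ x y w → h x y w ≡ h x w y
  h-swap₂₃ x y w with isZ (cls x) | isZ (cls y) | isZ (cls w)
  ... | true  | true  | true  = refl
  ... | true  | true  | false = refl
  ... | true  | false | true  = refl
  ... | true  | false | false = F-sym x y w
  ... | false | true  | true  = refl
  ... | false | true  | false = refl
  ... | false | false | true  = refl
  ... | false | false | false = refl

  h-F : ∀ z x y → isZ (cls z) ≡ true → isZ (cls x) ≡ false → isZ (cls y) ≡ false → h z x y ≡ F z x y
  h-F z x y z∈ x∉ y∉ rewrite z∈ | x∉ | y∉ = refl

  h-V-Y : ∀ z v y → cls z ≡ Z → cls v ≡ V → cls y ≡ Y → h z v y ≡ g z v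
  h-V-Y z v y z∈ v∈ y∈ = trans (h-F z v y (cong isZ z∈) (cong isZ v∈) (cong isZ y∈)) (F-< z v y
    (FinP.combine-monoˡ-< (blk v) (blk y) (subst₂ Fin._<_ (sym v∈) (sym y∈) (s≤s (s≤s z≤n)))))

  -- On Y the value of g is constantly true, and two vertices of Y in one block get the default of
  -- `F`, which is `true` for this reason.
  h-Y-Y : ∀ z y y′ → cls z ≡ Z → cls y ≡ Y → cls y′ ≡ Y → h z y y′ ≡ true
  h-Y-Y z y y′ z∈ y∈ y′∈ = trans (h-F z y y′ (cong isZ z∈) (cong isZ y∈) (cong isZ y′∈)) all-true
    where
    g-Y : ∀ z y → cls y ≡ Y → g z y ≡ true
    g-Y z y y∈ rewrite y∈ = refl
    all-true : F z y y′ ≡ true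
    all-true with FinP.<-cmp (rank y) (rank y′)
    ... | tri< lt _ _ = trans (F-< z y y′ lt) (g-Y z y y∈)
    ... | tri≈ _ eq _ = F-≡ z y y′ eq
    ... | tri> _ _ gt = trans (F-> z y y′ gt) (g-Y z y′ y′∈)

  -- A true triple has exactly one vertex in class Z, so a parity count
  -- over the three triples through z forces that vertex to be z.
  apex : ∀ a b c d {p q r p′ q′ r′ p″ q″ r″} →
    pick a b c p q r ≡ true → pick a b d p′ q′ r′ ≡ true → pick a c d p″ q″ r″ ≡ true →
    a ≡ true × b ≡ false × c ≡ false
  apex true  false false _     _ _ _ = refl , refl , refl
  apex false false true  false _ () _
  apex false false true  true  _ _ ()
  apex false true  false false _ _ ()
  apex false true  false true  _ () _
  apex false true  true  _     () _ _
  apex false false false _     () _ _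
  apex true  true  _     _     () _ _
  apex true  false true  _     () _ _

  -- The three vertices v, v′, y lie in different blocks, so one has least rank. If it is y, then
  -- zvy and zv′y both read g z y, yet differ. If it is v, then vv′ and vy read the same value, both
  -- for z and for z′, which gives true for z and false for z′. The case of v′ is symmetric.
  no-pattern : ∀ {z z′ v v′ y y′} → blk v ≢ blk v′ → blk v ≢ blk y → blk v′ ≢ blk y →
    h z v y ≡ true → h z v y′ ≡ true → h z y y′ ≡ true → h z v′ y ≡ false →
    h z′ v′ y ≡ true → h z′ v′ y′ ≡ true → h z′ y y′ ≡ true → h z′ v y ≡ false →
    h z v v′ ≢ h z′ v v′
  no-pattern {z} {z′} {v} {v′} {y} {y′} vv′ vy v′y zvy zvy′ zyy′ zv′y z′v′y z′v′y′ z′yy′ z′vy same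
    with apex (isZ (cls z)) (isZ (cls v)) (isZ (cls y)) (isZ (cls y′)) zvy zvy′ zyy′
       | apex (isZ (cls z′)) (isZ (cls v′)) (isZ (cls y)) (isZ (cls y′)) z′v′y z′v′y′ z′yy′
  ... | z∈ , v∉ , y∉ | z′∈ , v′∉ , _ = minimum (ordered v v′ vv′) (ordered v y vy) (ordered v′ y v′y)
    where
    ordered : ∀ x x′ → blk x ≢ blk x′ → rank x Fin.< rank x′ ⊎ rank x′ Fin.< rank x
    ordered x x′ x≢ with FinP.<-cmp (rank x) (rank x′)
    ... | tri< lt _ _ = inj₁ lt
    ... | tri≈ _ eq _ = ⊥-elim (x≢ (FinP.combine-injectiveʳ (cls x) (blk x) (cls x′) (blk x′) eq))
    ... | tri> _ _ gt = inj₂ gt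
    f-zvy : F z v y ≡ true
    f-zvy = trans (sym (h-F z v y z∈ v∉ y∉)) zvy
    f-zv′y : F z v′ y ≡ false
    f-zv′y = trans (sym (h-F z v′ y z∈ v′∉ y∉)) zv′y
    f-z′v′y : F z′ v′ y ≡ true
    f-z′v′y = trans (sym (h-F z′ v′ y z′∈ v′∉ y∉)) z′v′y
    f-z′vy : F z′ v y ≡ false
    f-z′vy = trans (sym (h-F z′ v y z′∈ v∉ y∉)) z′vy
    f-same : F z v v′ ≡ F z′ v v′
    f-same = trans (sym (h-F z v v′ z∈ v∉ v′∉)) (trans same (h-F z′ v v′ z′∈ v∉ v′∉))
    true≢false : true ≢ false
    true≢false ()
    y-least : rank y Fin.< rank v → rank y Fin.< rank v′ → ⊥
    y-least y<v y<v′ = true≢false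
      (trans (sym f-zvy) (trans (F-> z v y y<v) (trans (sym (F-> z v′ y y<v′)) f-zv′y)))
    v-least : rank v Fin.< rank v′ → rank v Fin.< rank y → ⊥
    v-least v<v′ v<y = true≢false (trans (sym f-zvy) (trans (F-< z v y v<y) (trans (sym (F-< z v v′ v<v′))
      (trans f-same (trans (F-< z′ v v′ v<v′) (trans (sym (F-< z′ v y v<y)) f-z′vy))))))
    v′-least : rank v′ Fin.< rank v → rank v′ Fin.< rank y → ⊥
    v′-least v′<v v′<y = true≢false (trans (sym f-z′v′y) (trans (F-< z′ v′ y v′<y) (trans (sym (F-> z′ v v′ v′<v))
      (trans (sym f-same) (trans (F-> z v v′ v′<v) (trans (sym (F-< z v′ y v′<y)) f-zv′y))))))
    minimum : rank v Fin.< rank v′ ⊎ rank v′ Fin.< rank v → rank v Fin.< rank y ⊎ rank y Fin.< rank v →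
              rank v′ Fin.< rank y ⊎ rank y Fin.< rank v′ → ⊥
    minimum (inj₁ v<v′) (inj₁ v<y)  _           = v-least v<v′ v<y
    minimum (inj₂ v′<v) _           (inj₁ v′<y) = v′-least v′<v v′<y
    minimum _           (inj₂ y<v)  (inj₂ y<v′) = y-least y<v y<v′
    minimum (inj₁ v<v′) (inj₂ y<v)  (inj₁ v′<y) = y-least y<v (FinP.<-trans y<v v<v′)
    minimum (inj₂ v′<v) (inj₁ v<y)  (inj₂ y<v′) = y-least (FinP.<-trans y<v′ v′<v) y<v′

  -- Automorphisms that flip unseen bits

  module Flip (o : Fin D → Bool) where

    moves : Fin 3 → Bool
    moves Y = false
    moves _ = true

    -- A bit is flipped only if its index and the type of its vertex both lie in `o`. With `o` the
    -- types missed by A, all of A stays in place. Y stays in place as well, so that z and its image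
    -- are compared by means of the same y and y′.
    flip : Fin 3 → Fin D → Fin D → Bool
    flip c k j = moves c ∧ (o k ∧ o j)

    σ : Fin n → Fin n
    σ x = mk (blk x) (cls x) (typ x) (λ j → bits x j xor flip (cls x) (typ x) j)

    blk-σ : ∀ x → blk (σ x) ≡ blk x
    blk-σ x = blk-mk _ _ _ _

    cls-σ : ∀ x → cls (σ x) ≡ cls x
    cls-σ x = cls-mk _ _ _ _

    typ-σ : ∀ x → typ (σ x) ≡ typ x
    typ-σ x = typ-mk _ _ _ _

    bits-σ : ∀ x j → bits (σ x) j ≡ bits x j xor flip (cls x) (typ x) j
    bits-σ x j = bits-mk (blk x) (cls x) (typ x) _ j

    xor-twice : ∀ a b → (a xor b) xor b ≡ a
    xor-twice a b = trans (BoolP.xor-assoc a b b) (trans (cong (a xor_) (BoolP.xor-same b)) (BoolP.xor-identityʳ a))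

    σ-involutive : ∀ x → σ (σ x) ≡ x
    σ-involutive x = ext
      (trans (blk-σ (σ x)) (blk-σ x)) (trans (cls-σ (σ x)) (cls-σ x)) (trans (typ-σ (σ x)) (typ-σ x))
      λ j → trans (bits-σ (σ x) j) (trans (cong₂ _xor_ (bits-σ x j) (cong₂ (λ c k → flip c k j) (cls-σ x) (typ-σ x))) (xor-twice (bits x j) _))

    σ-injective : Injective _≡_ _≡_ σ
    σ-injective {x} {y} eq = trans (sym (σ-involutive x)) (trans (cong σ eq) (σ-involutive y))

    σ-fixed : ∀ x → (∀ j → flip (cls x) (typ x) j ≡ false) → σ x ≡ x
    σ-fixed x none = ext (blk-σ x) (cls-σ x) (typ-σ x)
      λ j → trans (bits-σ x j) (trans (cong (bits x j xor_) (none j)) (BoolP.xor-identityʳ (bits x j)))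

    σ-fixes-type : ∀ x → o (typ x) ≡ false → σ x ≡ x
    σ-fixes-type x out = σ-fixed x λ j → trans (cong (λ b → moves (cls x) ∧ (b ∧ o j)) out) (BoolP.∧-zeroʳ (moves (cls x)))

    σ-fixes-Y : ∀ x → cls x ≡ Y → σ x ≡ x
    σ-fixes-Y x x∈ = σ-fixed x λ j → cong (λ c → flip c (typ x) j) x∈

    rank-σ : ∀ x → rank (σ x) ≡ rank x
    rank-σ x = cong₂ combine (cls-σ x) (blk-σ x)

    bits-σ-σ : ∀ z x → bits (σ z) (typ (σ x)) ≡ bits z (typ x) xor flip (cls z) (typ z) (typ x)
    bits-σ-σ z x = trans (cong (bits (σ z)) (typ-σ x)) (bits-σ z (typ x))

    -- For x outside Y, the bit of z at `typ x` is flipped exactly when the bit of x at `typ z` is,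
    -- since `o k ∧ o j` is symmetric, and the two flips cancel. On Y the value is constant.
    g-σ : ∀ z x → isZ (cls z) ≡ true → g (σ z) (σ x) ≡ g z x
    g-σ z x z∈ = trans (cong₂ value (cls-σ x) (cong₂ _xor_ (bits-σ-σ z x) (bits-σ-σ x z))) (cancel (cls z) (cls x) z∈)
      where
      cancel₂ : ∀ a b p q → (a xor (p ∧ q)) xor (b xor (q ∧ p)) ≡ a xor b
      cancel₂ false false false false = refl
      cancel₂ false false false true  = refl
      cancel₂ false false true  false = refl
      cancel₂ false false true  true  = refl
      cancel₂ false true  false false = refl
      cancel₂ false true  false true  = refl
      cancel₂ false true  true  false = refl
      cancel₂ false true  true  true  = refl
      cancel₂ true  false false false = refl
      cancel₂ true  false false true  = refl
      cancel₂ true  false true  false = refl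
      cancel₂ true  false true  true  = refl
      cancel₂ true  true  false false = refl
      cancel₂ true  true  false true  = refl
      cancel₂ true  true  true  false = refl
      cancel₂ true  true  true  true  = refl
      cancel : ∀ c d → isZ c ≡ true →
        value d ((bits z (typ x) xor flip c (typ z) (typ x)) xor (bits x (typ z) xor flip d (typ x) (typ z)))
        ≡ value d (bits z (typ x) xor bits x (typ z))
      cancel Z Z _ = cancel₂ (bits z (typ x)) (bits x (typ z)) (o (typ z)) (o (typ x))
      cancel Z V _ = cancel₂ (bits z (typ x)) (bits x (typ z)) (o (typ z)) (o (typ x))
      cancel Z Y _ = refl

    F-σ : ∀ z x y → isZ (cls z) ≡ true → F (σ z) (σ x) (σ y) ≡ F z x y
    F-σ z x y z∈ rewrite rank-σ x | rank-σ y | g-σ z x z∈ | g-σ z y z∈ = refl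

    pick-cong : ∀ a b c {p q r p′ q′ r′} → (a ≡ true → p ≡ p′) → (b ≡ true → q ≡ q′) → (c ≡ true → r ≡ r′) →
      pick a b c p q r ≡ pick a b c p′ q′ r′
    pick-cong true  true  true  _ _ _ = refl
    pick-cong true  true  false _ _ _ = refl
    pick-cong true  false true  _ _ _ = refl
    pick-cong true  false false p _ _ = p refl
    pick-cong false true  true  _ _ _ = refl
    pick-cong false true  false _ q _ = q refl
    pick-cong false false true  _ _ r = r refl
    pick-cong false false false _ _ _ = refl

    h-σ : ∀ x y w → h (σ x) (σ y) (σ w) ≡ h x y w
    h-σ x y w = trans
      (cong (λ f → f (F (σ x) (σ y) (σ w)) (F (σ y) (σ x) (σ w)) (F (σ w) (σ x) (σ y)))
        (cong₃ (cls-σ x) (cls-σ y) (cls-σ w)))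
      (pick-cong (isZ (cls x)) (isZ (cls y)) (isZ (cls w)) (F-σ x y w) (F-σ y x w) (F-σ w x y))
      where
      cong₃ : ∀ {a b c a′ b′ c′} → a ≡ a′ → b ≡ b′ → c ≡ c′ → pick (isZ a) (isZ b) (isZ c) ≡ pick (isZ a′) (isZ b′) (isZ c′)
      cong₃ refl refl refl = refl

    g-separates : ∀ z v → cls v ≡ V → o (typ z) ≡ true → o (typ v) ≡ true → g z (σ v) ≡ not (g z v)
    g-separates z v v∈ oz ov = begin
      g z (σ v)                                        ≡⟨ cong₂ value (trans (cls-σ v) v∈) (cong₂ _xor_ (cong (bits z) (typ-σ v)) (bits-σ v (typ z))) ⟩
      bits z (typ v) xor (bits v (typ z) xor flip (cls v) (typ v) (typ z))
        ≡⟨ cong (λ b → bits z (typ v) xor (bits v (typ z) xor b)) flipped ⟩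
      bits z (typ v) xor (bits v (typ z) xor true)     ≡⟨ negate (bits z (typ v)) (bits v (typ z)) ⟩
      not (bits z (typ v) xor bits v (typ z))          ≡⟨ cong (λ c → not (value c (bits z (typ v) xor bits v (typ z)))) v∈ ⟨
      not (g z v)                                      ∎
      where
      open ≡-Reasoning
      flipped : flip (cls v) (typ v) (typ z) ≡ true
      flipped rewrite v∈ | ov | oz = refl
      negate : ∀ a b → a xor (b xor true) ≡ not (a xor b)
      negate false false = refl
      negate false true  = refl
      negate true  false = refl
      negate true  true  = refl

-- Undirected structures of order three

Distinct : {X : Set} → X → X → X → Set
Distinct x y w = x ≢ y × x ≢ w × y ≢ w

distinct? : ∀ {n} (x y w : Fin n) → Dec (Distinct x y w)
distinct? x y w = ¬? (x FinP.≟ y) ×-dec (¬? (x FinP.≟ w) ×-dec ¬? (y FinP.≟ w))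

distinct-swap₁₂ : ∀ {X : Set} {x y w : X} → Distinct x y w → Distinct y x w
distinct-swap₁₂ (xy , xw , yw) = xy ∘ sym , yw , xw

distinct-swap₂₃ : ∀ {X : Set} {x y w : X} → Distinct x y w → Distinct x w y
distinct-swap₂₃ (xy , xw , yw) = xw , xy , yw ∘ sym

distinct-map : ∀ {X X′ : Set} {f : X → X′} → Injective _≡_ _≡_ f → ∀ {x y w} → Distinct x y w → Distinct (f x) (f y) (f w)
distinct-map finj (xy , xw , yw) = xy ∘ finj , xw ∘ finj , yw ∘ finj

triple-injective : ∀ {X : Set} {x y w : X} → Distinct x y w → InjTuple (x ∷ y ∷ w ∷ [])
triple-injective d                {zero}           {zero}           _  = refl
triple-injective (xy , xw , yw)   {zero}           {suc zero}       eq = ⊥-elim (xy eq)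
triple-injective (xy , xw , yw)   {zero}           {suc (suc zero)} eq = ⊥-elim (xw eq)
triple-injective (xy , xw , yw)   {suc zero}       {zero}           eq = ⊥-elim (xy (sym eq))
triple-injective d                {suc zero}       {suc zero}       _  = refl
triple-injective (xy , xw , yw)   {suc zero}       {suc (suc zero)} eq = ⊥-elim (yw eq)
triple-injective (xy , xw , yw)   {suc (suc zero)} {zero}           eq = ⊥-elim (xw (sym eq))
triple-injective (xy , xw , yw)   {suc (suc zero)} {suc zero}       eq = ⊥-elim (yw (sym eq))
triple-injective d                {suc (suc zero)} {suc (suc zero)} _  = refl

triple-distinct : ∀ {X : Set} {x y w : X} → InjTuple (x ∷ y ∷ w ∷ []) → Distinct x y w
triple-distinct p =
  (λ eq → FinP.0≢1+n (p {zero} {suc zero} eq)) ,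
  (λ eq → FinP.0≢1+n (p {zero} {suc (suc zero)} eq)) ,
  (λ eq → FinP.0≢1+n (FinP.suc-injective (p {suc zero} {suc (suc zero)} eq)))

pair-distinct : ∀ {X : Set} {x y : X} → InjTuple (x ∷ y ∷ []) → x ≢ y
pair-distinct p eq = FinP.0≢1+n (p {zero} {suc zero} eq)

-- Shared by (b) and (c). The structure uses two colours of level three only and is constant on all
-- other levels.
module OrderThree (K : Palette) (c₀ c₁ : Col K 3) (c₀≢c₁ : c₀ ≢ c₁)
                  (single-above : ∀ j → card K (4 + j) ≡ 1) where

  Symmetric₂ : ∀ {n} → Hyp K (Fin n) → Set
  Symmetric₂ G = ∀ x y .(p : InjTuple (x ∷ y ∷ [])) .(q : InjTuple (y ∷ x ∷ [])) →
    col G 2 (x ∷ y ∷ []) p ≡ col G 2 (y ∷ x ∷ []) q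

  -- Two adjacent transpositions generate all permutations of three positions; `permute₃` writes out
  -- the words.
  Symmetric₃ : ∀ {n} → Hyp K (Fin n) → Set
  Symmetric₃ G = ∀ x y w .(d : Distinct x y w) →
    col G 3 (x ∷ y ∷ w ∷ []) (triple-injective d) ≡ col G 3 (y ∷ x ∷ w ∷ []) (triple-injective (distinct-swap₁₂ d)) ×
    col G 3 (x ∷ y ∷ w ∷ []) (triple-injective d) ≡ col G 3 (x ∷ w ∷ y ∷ []) (triple-injective (distinct-swap₂₃ d))

  -- The value nothing marks triples that are not injective.
  edge : ∀ {n} → Hyp K (Fin n) → Fin n → Fin n → Fin n → Maybe Bool
  edge G x y w with distinct? x y w
  ... | yes d = just (does (col G 3 (x ∷ y ∷ w ∷ []) (triple-injective d) FinP.≟ c₁))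
  ... | no _  = nothing

  -- For a hypergraph of the form h, the true edges force z and z′ into Z and the other vertices out of it,
  -- and then z and z′ disagree on which of v, v′ comes first.
  Pattern : ∀ {n} → Hyp K (Fin n) → (z z′ v v′ y y′ : Fin n) → Set
  Pattern G z z′ v v′ y y′ =
    edge G z  v  y ≡ just true × edge G z  v  y′ ≡ just true × edge G z  y y′ ≡ just true × edge G z  v′ y ≡ just false ×
    edge G z′ v′ y ≡ just true × edge G z′ v′ y′ ≡ just true × edge G z′ y y′ ≡ just true × edge G z′ v  y ≡ just false ×
    edge G z v v′ ≡ edge G z′ v v′

  record Good {n} (G : Hyp K (Fin n)) : Set where
    constructor good
    field
      symmetric₂ : Symmetric₂ G
      symmetric₃ : Symmetric₃ G
      no-pattern : ∀ z z′ v v′ y y′ → ¬ Pattern G z z′ v v′ y y′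

  open Good

  edge-distinct : ∀ {n} (G : Hyp K (Fin n)) {x y w} (d : Distinct x y w) →
    edge G x y w ≡ just (does (col G 3 (x ∷ y ∷ w ∷ []) (triple-injective d) FinP.≟ c₁))
  edge-distinct G {x} {y} {w} d with distinct? x y w
  ... | yes _ = refl
  ... | no ¬d = ⊥-elim (¬d d)

  edge-indistinct : ∀ {n} (G : Hyp K (Fin n)) {x y w} → ¬ Distinct x y w → edge G x y w ≡ nothing
  edge-indistinct G {x} {y} {w} ¬d with distinct? x y w
  ... | yes d = ⊥-elim (¬d d)
  ... | no _  = refl

  edge-just : ∀ {n} (G : Hyp K (Fin n)) {x y w b} → edge G x y w ≡ just b → Distinct x y w
  edge-just G {x} {y} {w} eq with distinct? x y w
  edge-just G eq | yes d = d
  edge-just G () | no _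

  edge-pull : ∀ {m n} (f : Fin m → Fin n) (finj : Injective _≡_ _≡_ f) (G : Hyp K (Fin n)) x y w →
    edge (pull f finj G) x y w ≡ edge G (f x) (f y) (f w)
  edge-pull f finj G x y w with distinct? x y w
  ... | yes d = sym (edge-distinct G (distinct-map finj d))
  ... | no ¬d = sym (edge-indistinct G λ (xy , xw , yw) → ¬d (xy ∘ cong f , xw ∘ cong f , yw ∘ cong f))

  edge-resp : ∀ {n} {G H : Hyp K (Fin n)} → G ≈ H → ∀ x y w → edge G x y w ≡ edge H x y w
  edge-resp G≈H x y w with distinct? x y w
  ... | yes d = cong (λ c → just (does (c FinP.≟ c₁))) (G≈H 3 (x ∷ y ∷ w ∷ []) (triple-injective d))
  ... | no _  = refl

  edge-swap₂₃ : ∀ {n} {G : Hyp K (Fin n)} → Symmetric₃ G → ∀ x y w → edge G x y w ≡ edge G x w y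
  edge-swap₂₃ {G = G} G-sym x y w with distinct? x y w
  ... | yes d = trans (cong (λ c → just (does (c FinP.≟ c₁))) (proj₂ (G-sym x y w d))) (sym (edge-distinct G (distinct-swap₂₃ d)))
  ... | no ¬d = sym (edge-indistinct G (¬d ∘ distinct-swap₂₃))

  pattern-resp : ∀ {m n} {G : Hyp K (Fin m)} {H : Hyp K (Fin n)} (f : Fin m → Fin n) →
    (∀ x y w → edge G x y w ≡ edge H (f x) (f y) (f w)) →
    ∀ {z z′ v v′ y y′} → Pattern G z z′ v v′ y y′ → Pattern H (f z) (f z′) (f v) (f v′) (f y) (f y′)
  pattern-resp f eq (p₁ , p₂ , p₃ , p₄ , p₅ , p₆ , p₇ , p₈ , p₉) =
    trans (sym (eq _ _ _)) p₁ , trans (sym (eq _ _ _)) p₂ , trans (sym (eq _ _ _)) p₃ , trans (sym (eq _ _ _)) p₄ ,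
    trans (sym (eq _ _ _)) p₅ , trans (sym (eq _ _ _)) p₆ , trans (sym (eq _ _ _)) p₇ , trans (sym (eq _ _ _)) p₈ ,
    trans (sym (eq _ _ _)) (trans p₉ (eq _ _ _))

  pattern? : ∀ {n} (G : Hyp K (Fin n)) z z′ v v′ y y′ → Dec (Pattern G z z′ v v′ y y′)
  pattern? G z z′ v v′ y y′ =
    edge G z  v  y ≟ just true ×-dec edge G z  v  y′ ≟ just true ×-dec edge G z  y y′ ≟ just true ×-dec edge G z  v′ y ≟ just false ×-dec
    edge G z′ v′ y ≟ just true ×-dec edge G z′ v′ y′ ≟ just true ×-dec edge G z′ y y′ ≟ just true ×-dec edge G z′ v  y ≟ just false ×-dec
    edge G z v v′ ≟ edge G z′ v v′
    where
    infix 4 _≟_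
    _≟_ = MaybeP.≡-dec BoolP._≟_

  symmetric₂? : ∀ {n} (G : Hyp K (Fin n)) → Dec (Symmetric₂ G)
  symmetric₂? G = FinP.all? λ x → FinP.all? λ y → check x y
    where
    check : ∀ x y → Dec (.(p : InjTuple (x ∷ y ∷ [])) .(q : InjTuple (y ∷ x ∷ [])) → col G 2 (x ∷ y ∷ []) p ≡ col G 2 (y ∷ x ∷ []) q)
    check x y with x FinP.≟ y
    ... | yes x≡y = yes λ p _ → ⊥-elim-irr (pair-distinct p x≡y)
    ... | no x≢y with col G 2 (x ∷ y ∷ []) (pair-injective x≢y) FinP.≟ col G 2 (y ∷ x ∷ []) (pair-injective (x≢y ∘ sym))
    ... | yes same = yes λ _ _ → same
    ... | no diff  = no λ all → diff (all (pair-injective x≢y) (pair-injective (x≢y ∘ sym)))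

  symmetric₃? : ∀ {n} (G : Hyp K (Fin n)) → Dec (Symmetric₃ G)
  symmetric₃? G = FinP.all? λ x → FinP.all? λ y → FinP.all? λ w → check x y w
    where
    check : ∀ x y w → Dec (.(d : Distinct x y w) →
      col G 3 (x ∷ y ∷ w ∷ []) (triple-injective d) ≡ col G 3 (y ∷ x ∷ w ∷ []) (triple-injective (distinct-swap₁₂ d)) ×
      col G 3 (x ∷ y ∷ w ∷ []) (triple-injective d) ≡ col G 3 (x ∷ w ∷ y ∷ []) (triple-injective (distinct-swap₂₃ d)))
    check x y w with distinct? x y w
    ... | no ¬d = yes λ d → ⊥-elim-irr (¬d d)
    ... | yes d with (col G 3 (x ∷ y ∷ w ∷ []) (triple-injective d) FinP.≟ col G 3 (y ∷ x ∷ w ∷ []) (triple-injective (distinct-swap₁₂ d)))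
                ×-dec (col G 3 (x ∷ y ∷ w ∷ []) (triple-injective d) FinP.≟ col G 3 (x ∷ w ∷ y ∷ []) (triple-injective (distinct-swap₂₃ d)))
    ... | yes same = yes λ _ → same
    ... | no diff  = no λ all → diff (all d)

  good? : ∀ {n} (G : Hyp K (Fin n)) → Dec (Good G)
  good? G with symmetric₂? G | symmetric₃? G
             | FinP.all? (λ z → FinP.all? λ z′ → FinP.all? λ v → FinP.all? λ v′ → FinP.all? λ y → FinP.all? λ y′ → ¬? (pattern? G z z′ v v′ y y′))
  ... | yes s₂ | yes s₃ | yes np = yes (good s₂ s₃ np)
  ... | no ¬s₂ | _      | _      = no (¬s₂ ∘ symmetric₂)
  ... | yes _  | no ¬s₃ | _      = no (¬s₃ ∘ symmetric₃)
  ... | yes _  | yes _  | no ¬np = no (¬np ∘ no-pattern)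

  good-pull : ∀ {m n} (f : Fin m → Fin n) (finj : Injective _≡_ _≡_ f) {G : Hyp K (Fin n)} → Good G → Good (pull f finj G)
  good-pull f finj {G} G-good = good
    (λ x y p q → symmetric₂ G-good (f x) (f y) (map-inj f finj (x ∷ y ∷ []) p) (map-inj f finj (y ∷ x ∷ []) q))
    (λ x y w d → symmetric₃ G-good (f x) (f y) (f w) (distinct-map finj d))
    (λ z z′ v v′ y y′ → no-pattern G-good (f z) (f z′) (f v) (f v′) (f y) (f y′) ∘ pattern-resp {G = pull f finj G} {G} f (edge-pull f finj G))

  good-resp : ∀ {n} {G H : Hyp K (Fin n)} → G ≈ H → Good G → Good H
  good-resp {G = G} {H} G≈H G-good = good
    (λ x y p q → trans (sym (G≈H 2 _ p)) (trans (symmetric₂ G-good x y p q) (G≈H 2 _ q)))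
    (λ x y w d → let s₁₂ , s₂₃ = symmetric₃ G-good x y w d in
      trans (sym (G≈H 3 _ (triple-injective d))) (trans s₁₂ (G≈H 3 _ (triple-injective (distinct-swap₁₂ d)))) ,
      trans (sym (G≈H 3 _ (triple-injective d))) (trans s₂₃ (G≈H 3 _ (triple-injective (distinct-swap₂₃ d)))))
    (λ z z′ v v′ y y′ → no-pattern G-good z z′ v v′ y y′ ∘ pattern-resp {G = H} {G} id (λ x y w → sym (edge-resp {G = G} {H} G≈H x y w)))

  goodProperty : Property K
  goodProperty = record
    { mem        = λ n G → does (good? G)
    ; respects   = λ n {G} {H} G≈H → does-⇔
        (mk⇔ (good-resp {G = G} {H} G≈H) (good-resp {G = H} {G} (λ j v p → sym (G≈H j v p)))) (good? G) (good? H)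
    ; hereditary = λ m n φ φinj G G∈ → dec-true (good? (pull φ φinj G)) (good-pull φ φinj (does⇒true (good? G) G∈))
    }

  module _ {n} (G : Hyp K (Fin n)) where

    permute₂ : Symmetric₂ G → ∀ {x y} (a b : Fin 2) → let v = x ∷ y ∷ [] in
      .(p : InjTuple v) .(q : InjTuple (lookup v a ∷ lookup v b ∷ [])) →
      col G 2 (lookup v a ∷ lookup v b ∷ []) q ≡ col G 2 v p
    permute₂ G-sym zero       (suc zero) p q = refl
    permute₂ G-sym (suc zero) zero       p q = G-sym _ _ q p
    permute₂ G-sym zero       zero       p q = ⊥-elim-irr (pair-distinct q refl)
    permute₂ G-sym (suc zero) (suc zero) p q = ⊥-elim-irr (pair-distinct q refl)

    permute₃ : Symmetric₃ G → ∀ {x y w} (a b c : Fin 3) → let v = x ∷ y ∷ w ∷ [] in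
      .(d : Distinct x y w) .(e : Distinct (lookup v a) (lookup v b) (lookup v c)) →
      col G 3 (lookup v a ∷ lookup v b ∷ lookup v c ∷ []) (triple-injective e) ≡ col G 3 v (triple-injective d)
    permute₃ G-sym zero             (suc zero)       (suc (suc zero)) d e = refl
    permute₃ G-sym zero             (suc (suc zero)) (suc zero)       d e = sym (proj₂ (G-sym _ _ _ d))
    permute₃ G-sym (suc zero)       zero             (suc (suc zero)) d e = sym (proj₁ (G-sym _ _ _ d))
    permute₃ G-sym (suc zero)       (suc (suc zero)) zero             d e =
      sym (trans (proj₁ (G-sym _ _ _ d)) (proj₂ (G-sym _ _ _ (distinct-swap₁₂ d))))
    permute₃ G-sym (suc (suc zero)) zero             (suc zero)       d e =
      sym (trans (proj₂ (G-sym _ _ _ d)) (proj₁ (G-sym _ _ _ (distinct-swap₂₃ d))))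
    permute₃ G-sym (suc (suc zero)) (suc zero)       zero             d e =
      sym (trans (proj₁ (G-sym _ _ _ d)) (trans (proj₂ (G-sym _ _ _ (distinct-swap₁₂ d)))
        (proj₁ (G-sym _ _ _ (distinct-swap₂₃ (distinct-swap₁₂ d))))))
    permute₃ G-sym zero             zero             _                d e = ⊥-elim-irr (proj₁ e refl)
    permute₃ G-sym (suc zero)       (suc zero)       _                d e = ⊥-elim-irr (proj₁ e refl)
    permute₃ G-sym (suc (suc zero)) (suc (suc zero)) _                d e = ⊥-elim-irr (proj₁ e refl)
    permute₃ G-sym zero             (suc zero)       zero             d e = ⊥-elim-irr (proj₁ (proj₂ e) refl)
    permute₃ G-sym zero             (suc (suc zero)) zero             d e = ⊥-elim-irr (proj₁ (proj₂ e) refl)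
    permute₃ G-sym (suc zero)       zero             (suc zero)       d e = ⊥-elim-irr (proj₁ (proj₂ e) refl)
    permute₃ G-sym (suc zero)       (suc (suc zero)) (suc zero)       d e = ⊥-elim-irr (proj₁ (proj₂ e) refl)
    permute₃ G-sym (suc (suc zero)) zero             (suc (suc zero)) d e = ⊥-elim-irr (proj₁ (proj₂ e) refl)
    permute₃ G-sym (suc (suc zero)) (suc zero)       (suc (suc zero)) d e = ⊥-elim-irr (proj₁ (proj₂ e) refl)
    permute₃ G-sym zero             (suc zero)       (suc zero)       d e = ⊥-elim-irr (proj₂ (proj₂ e) refl)
    permute₃ G-sym zero             (suc (suc zero)) (suc (suc zero)) d e = ⊥-elim-irr (proj₂ (proj₂ e) refl)
    permute₃ G-sym (suc zero)       zero             zero             d e = ⊥-elim-irr (proj₂ (proj₂ e) refl)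
    permute₃ G-sym (suc zero)       (suc (suc zero)) (suc (suc zero)) d e = ⊥-elim-irr (proj₂ (proj₂ e) refl)
    permute₃ G-sym (suc (suc zero)) zero             zero             d e = ⊥-elim-irr (proj₂ (proj₂ e) refl)
    permute₃ G-sym (suc (suc zero)) (suc zero)       (suc zero)       d e = ⊥-elim-irr (proj₂ (proj₂ e) refl)

  singleton : ∀ {k} → k ≡ 1 → (i j : Fin k) → i ≡ j
  singleton refl zero zero = refl

  good⇒undirected : ∀ {n} (G : Hyp K (Fin n)) → Good G → Undirected G
  good⇒undirected G G-good 0 [] p σ _ = refl
  good⇒undirected G G-good 1 (x ∷ []) p σ _ = col-cong G _ p (cong (λ i → lookup (x ∷ []) i ∷ []) (singleton refl (σ zero) zero))
  good⇒undirected G G-good 2 (x ∷ y ∷ []) p σ σinj = permute₂ G (symmetric₂ G-good) (σ zero) (σ (suc zero)) p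
    (pair-injective (λ eq → FinP.0≢1+n (σinj (p eq))))
  good⇒undirected G G-good 3 (x ∷ y ∷ w ∷ []) p σ σinj =
    permute₃ G (symmetric₃ G-good) (σ zero) (σ (suc zero)) (σ (suc (suc zero))) (triple-distinct p)
    ((λ eq → FinP.0≢1+n (σinj (p eq))) , (λ eq → FinP.0≢1+n (σinj (p eq))) , (λ eq → FinP.0≢1+n (FinP.suc-injective (σinj (p eq)))))
  good⇒undirected G G-good (suc (suc (suc (suc j)))) v p σ σinj = singleton (single-above j) _ _

  module Coded {L D n q : ℕ} (𝓒 : Coding L D n q) where

    open Coding 𝓒
    open Graph 𝓒 renaming (no-pattern to h-no-pattern)

    paint : Bool → Col K 3
    paint true  = c₁
    paint false = c₀

    paint-c₁ : ∀ b → does (paint b FinP.≟ c₁) ≡ b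
    paint-c₁ true  = dec-true (c₁ FinP.≟ c₁) refl
    paint-c₁ false = dec-false (c₀ FinP.≟ c₁) c₀≢c₁

    default : ∀ j → Col K j
    default j = Fin.fromℕ< (nonempty K j)

    hypergraph : Hyp K (Fin n)
    hypergraph = hyp colour
      where
      colour : (j : ℕ) (v : Vec (Fin n) j) → .(InjTuple v) → Col K j
      colour 0 _ _ = default 0
      colour 1 _ _ = default 1
      colour 2 _ _ = default 2
      colour 3 (x ∷ y ∷ w ∷ []) _ = paint (h x y w)
      colour j@(suc (suc (suc (suc _)))) _ _ = default j

    edge-hypergraph : ∀ {x y w} → Distinct x y w → edge hypergraph x y w ≡ just (h x y w)
    edge-hypergraph {x} {y} {w} d = trans (edge-distinct hypergraph d) (cong just (paint-c₁ (h x y w)))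

    hypergraph-invariant : ∀ σ (σinj : Injective _≡_ _≡_ σ) → (∀ x y w → h (σ x) (σ y) (σ w) ≡ h x y w) →
      pull σ σinj hypergraph ≈ hypergraph
    hypergraph-invariant σ σinj inv 0 _ _ = refl
    hypergraph-invariant σ σinj inv 1 _ _ = refl
    hypergraph-invariant σ σinj inv 2 _ _ = refl
    hypergraph-invariant σ σinj inv 3 (x ∷ y ∷ w ∷ []) _ = cong paint (inv x y w)
    hypergraph-invariant σ σinj inv (suc (suc (suc (suc _)))) _ _ = refl

    just-true≢just-false : ∀ {e : Maybe Bool} → e ≡ just true → e ≢ just false
    just-true≢just-false refl ()

    transversal-good : ∀ {N} (f : Fin N → Fin n) (finj : Injective _≡_ _≡_ f) → Injective _≡_ _≡_ (blk ∘ f) →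
      Good (pull f finj hypergraph)
    transversal-good f finj tr = good
      (λ _ _ _ _ → refl)
      (λ x y w _ → cong paint (h-swap₁₂ (f x) (f y) (f w)) , cong paint (h-swap₂₃ (f x) (f y) (f w)))
      patternless
      where
      H : Hyp K (Fin _)
      H = pull f finj hypergraph
      edge-H : ∀ {x y w} → Distinct x y w → edge H x y w ≡ just (h (f x) (f y) (f w))
      edge-H d = trans (edge-pull f finj hypergraph _ _ _) (edge-hypergraph (distinct-map finj d))
      h-value : ∀ {x y w b} → edge H x y w ≡ just b → h (f x) (f y) (f w) ≡ b
      h-value eq = MaybeP.just-injective (trans (sym (edge-H (edge-just H eq))) eq)
      patternless : ∀ z z′ v v′ y y′ → ¬ Pattern H z z′ v v′ y y′
      patternless z z′ v v′ y y′ (zvy , zvy′ , zyy′ , zv′y , z′v′y , z′v′y′ , z′yy′ , z′vy , same) =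
        h-no-pattern (v≢v′ ∘ tr) (v≢y ∘ tr) (v′≢y ∘ tr)
          (h-value zvy) (h-value zvy′) (h-value zyy′) (h-value zv′y)
          (h-value z′v′y) (h-value z′v′y′) (h-value z′yy′) (h-value z′vy)
          -- The last clause of `Pattern` would also hold between two degenerate triples. The other
          -- edges exclude this: they make z, v, v′ distinct, and likewise z′, v, v′.
          (MaybeP.just-injective (trans (sym (edge-H (z≢v , z≢v′ , v≢v′))) (trans same (edge-H (z′≢v , z′≢v′ , v≢v′)))))
        where
        z≢v = proj₁ (edge-just H zvy)
        z≢v′ = proj₁ (edge-just H zv′y)
        z′≢v = proj₁ (edge-just H z′vy)
        z′≢v′ = proj₁ (edge-just H z′v′y)
        v≢y = proj₂ (proj₂ (edge-just H zvy))
        v′≢y = proj₂ (proj₂ (edge-just H z′v′y))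
        v≢v′ : v ≢ v′
        v≢v′ refl = just-true≢just-false zvy zv′y

    module Repaired {a m : ℕ} (R : Rule K a) (β : (Fin a ⊎ Fin m) ⤖ Fin n) where

      TG : Hyp K (Fin m)
      TG = T R (fin m) (pull (⤖-to β) (⤖-injective β) hypergraph)

      emb : Fin m → Fin n
      emb x = ⤖-to β (inj₂ x)

      emb-injective : Injective _≡_ _≡_ emb
      emb-injective eq = SumP.inj₂-injective (⤖-injective β eq)

      used? : ∀ k → Dec (∃ λ i → typ (⤖-to β (inj₁ i)) ≡ k)
      used? k = FinP.any? λ i → typ (⤖-to β (inj₁ i)) FinP.≟ k

      o : Fin D → Bool
      o k = not (does (used? k))

      open Flip o

      o-unused : ∀ {k} → ¬ (∃ λ i → typ (⤖-to β (inj₁ i)) ≡ k) → o k ≡ true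
      o-unused {k} unused = cong not (dec-false (used? k) unused)

      open LiftAutomorphism R β hypergraph σ σ-injective (hypergraph-invariant σ σ-injective h-σ)
        (λ i → σ-fixes-type _ (cong not (dec-true (used? _) (i , refl))))

      edge-lift : ∀ x y w → edge TG (lift x) (lift y) (lift w) ≡ edge TG x y w
      edge-lift x y w = trans (sym (edge-pull lift lift-injective TG x y w))
        (edge-resp {G = pull lift lift-injective TG} {TG} T-invariant x y w)

      -- Stated for vertices of the original structure. Triples that meet A or repeat a vertex fail
      -- it, so the modified triples can be counted among all n³ ordered triples.
      Unmodified : Fin n → Fin n → Fin n → Set
      Unmodified x₁ x₂ x₃ = ∃ λ x → ∃ λ y → ∃ λ w →
        emb x ≡ x₁ × emb y ≡ x₂ × emb w ≡ x₃ × edge TG x y w ≡ just (h x₁ x₂ x₃)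

      unmodified? : ∀ x₁ x₂ x₃ → Dec (Unmodified x₁ x₂ x₃)
      unmodified? x₁ x₂ x₃ = FinP.any? λ x → FinP.any? λ y → FinP.any? λ w →
        emb x FinP.≟ x₁ ×-dec emb y FinP.≟ x₂ ×-dec emb w FinP.≟ x₃ ×-dec MaybeP.≡-dec BoolP._≟_ (edge TG x y w) (just (h x₁ x₂ x₃))

      unmodified-edge : ∀ {x y w x₁ x₂ x₃} → Unmodified x₁ x₂ x₃ → emb x ≡ x₁ → emb y ≡ x₂ → emb w ≡ x₃ →
        edge TG x y w ≡ just (h x₁ x₂ x₃)
      unmodified-edge (x′ , y′ , w′ , refl , refl , refl , eq) x≡ y≡ w≡
        with refl ← emb-injective x≡ | refl ← emb-injective y≡ | refl ← emb-injective w≡ = eq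

      module _ (TG-good : Good TG) where

        -- The pair (lift z, lift u) is a copy of (z, u) with the roles of u and lift u exchanged,
        -- whereas the edge containing both u and lift u is the same for z and lift z.
        forbidden : ∀ {z u y y′} → cls z ≡ Z → cls u ≡ V → cls y ≡ Y → cls y′ ≡ Y →
          g z u ≡ true → g z (σ u) ≡ false →
          Unmodified z u y → Unmodified z u y′ → Unmodified z y y′ → Unmodified z (σ u) y → ⊥
        forbidden {z} {u} {y} {y′} z∈ u∈ y∈ y′∈ gu gσu
          Uzuy@(z′ , u′ , y₁ , refl , refl , refl , _) Uzuy′ Uzyy′@(_ , _ , y₂ , _ , _ , refl , _) Uzσuy =
          no-pattern TG-good z′ (lift z′) u′ (lift u′) y₁ y₂
            ( zuy , zuy′ , zyy′ , zσuy
            , trans (cong (edge TG _ _) (sym fix₁)) (trans (edge-lift _ _ _) zuy)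
            , trans (cong (edge TG _ _) (sym fix₂)) (trans (edge-lift _ _ _) zuy′)
            , trans (cong₂ (edge TG _) (sym fix₁) (sym fix₂)) (trans (edge-lift _ _ _) zyy′)
            , trans (cong₂ (edge TG _) (sym twice) (sym fix₁)) (trans (edge-lift _ _ _) zσuy)
            -- `lift` interchanges u′ and `lift u′`, so the edge returns with its last two vertices
            -- swapped; symmetry of `TG` puts them back.
            , sym (trans (cong (λ t → edge TG (lift z′) t (lift u′)) (sym twice)) (trans (edge-lift _ _ _)
                (edge-swap₂₃ {G = TG} (symmetric₃ TG-good) _ _ _))) )
          where
          value-of : ∀ {b x₁ x₂ x₃} → h x₁ x₂ x₃ ≡ b → ∀ {x y w} → Unmodified x₁ x₂ x₃ → emb x ≡ x₁ → emb y ≡ x₂ → emb w ≡ x₃ → edge TG x y w ≡ just b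
          value-of h≡ U x≡ y≡ w≡ = trans (unmodified-edge U x≡ y≡ w≡) (cong just h≡)
          zuy : edge TG z′ u′ y₁ ≡ just true
          zuy = value-of (trans (h-V-Y _ _ _ z∈ u∈ y∈) gu) Uzuy refl refl refl
          zuy′ : edge TG z′ u′ y₂ ≡ just true
          zuy′ = value-of (trans (h-V-Y _ _ _ z∈ u∈ y′∈) gu) Uzuy′ refl refl refl
          zyy′ : edge TG z′ y₁ y₂ ≡ just true
          zyy′ = value-of (h-Y-Y _ _ _ z∈ y∈ y′∈) Uzyy′ refl refl refl
          zσuy : edge TG z′ (lift u′) y₁ ≡ just false
          zσuy = value-of (trans (h-V-Y _ _ _ z∈ (trans (cls-σ _) u∈) y∈) gσu) Uzσuy refl (lift-σ u′) refl
          fix₁ : lift y₁ ≡ y₁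
          fix₁ = lift-unique (sym (σ-fixes-Y _ y∈))
          fix₂ : lift y₂ ≡ y₂
          fix₂ = lift-unique (sym (σ-fixes-Y _ y′∈))
          twice : lift (lift u′) ≡ u′
          twice = lift-unique (sym (trans (cong σ (lift-σ u′)) (σ-involutive _)))

        -- Since g z differs at v and σ v, exactly one of them can play u in `forbidden`. The
        -- hypotheses on both v and σ v cover either case.
        modified : ∀ {z v y y′} → cls z ≡ Z → cls v ≡ V → cls y ≡ Y → cls y′ ≡ Y → o (typ z) ≡ true → o (typ v) ≡ true →
          Unmodified z v y → Unmodified z v y′ → Unmodified z y y′ → Unmodified z (σ v) y → Unmodified z (σ v) y′ → ⊥
        modified {z} {v} {y} z∈ v∈ y∈ y′∈ oz ov Uzvy Uzvy′ Uzyy′ Uzσvy Uzσvy′ = by-value (g z v) refl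
          where
          gσv : ∀ {b} → g z v ≡ b → g z (σ v) ≡ not b
          gσv gv = trans (g-separates z v v∈ oz ov) (cong not gv)
          by-value : ∀ b → g z v ≡ b → ⊥
          by-value true  gv = forbidden z∈ v∈ y∈ y′∈ gv (gσv gv) Uzvy Uzvy′ Uzyy′ Uzσvy
          by-value false gv = forbidden z∈ (trans (cls-σ v) v∈) y∈ y′∈ (gσv gv) (trans (cong (g z) (σ-involutive v)) gv)
            Uzσvy Uzσvy′ Uzyy′ (subst (λ t → Unmodified z t y) (sym (σ-involutive v)) Uzvy)

-- Counting modified triples

∑³ : ∀ {n} → (Fin n → Fin n → Fin n → ℕ) → ℕ
∑³ f = sum λ i → sum λ j → sum λ k → f i j k

∑³-injective : ∀ {q n} (f g h : Fin q → Fin n) → Injective _≡_ _≡_ f → Injective _≡_ _≡_ g → Injective _≡_ _≡_ h →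
  (t : Fin n → Fin n → Fin n → ℕ) → ∑³ (λ i j k → t (f i) (g j) (h k)) ≤ ∑³ t
∑³-injective f g h f-inj g-inj h-inj t =
  ≤-trans (∑-mono λ i → ≤-trans (∑-mono λ j → ∑-injective h h-inj (t (f i) (g j)))
                                (∑-injective g g-inj (λ y → sum (t (f i) y))))
          (∑-injective f f-inj (λ x → sum λ y → sum (t x y)))

∑³-combine : ∀ {n} (t : Fin n → Fin n → Fin n → ℕ) (f : Fin (n * (n * n)) → ℕ) →
  (∀ x y w → f (combine x (combine y w)) ≡ t x y w) → sum f ≡ ∑³ t
∑³-combine {n} t f eq = trans (∑-combine {n} {n * n} f) (sum-cong-≗ λ x →
  trans (∑-combine {n} {n} (λ s → f (combine x s))) (sum-cong-≗ λ y → sum-cong-≗ λ w → eq x y w))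

module _ {q : ℕ} where

  ∑⁴ : (Fin q → Fin q → Fin q → Fin q → ℕ) → ℕ
  ∑⁴ f = sum λ i → ∑³ (f i)

  scale : ∀ (f : Fin q → ℕ) → sum (λ i → q * f i) ≡ q * sum f
  scale f = sym (*-distribˡ-sum q f)

  ∑⁴-drop₄ : ∀ t → ∑⁴ (λ i j k l → t i j k) ≡ q * ∑³ t
  ∑⁴-drop₄ t = trans (sum-cong-≗ λ i → trans (sum-cong-≗ λ j → trans (sum-cong-≗ λ k → ∑-const q (t i j k))
    (scale (t i j))) (scale (λ j → sum (t i j)))) (scale (λ i → sum λ j → sum (t i j)))

  ∑⁴-drop₃ : ∀ t → ∑⁴ (λ i j k l → t i j l) ≡ q * ∑³ t
  ∑⁴-drop₃ t = trans (sum-cong-≗ λ i → trans (sum-cong-≗ λ j → ∑-const q (sum (t i j)))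
    (scale (λ j → sum (t i j)))) (scale (λ i → sum λ j → sum (t i j)))

  ∑⁴-drop₂ : ∀ t → ∑⁴ (λ i j k l → t i k l) ≡ q * ∑³ t
  ∑⁴-drop₂ t = trans (sum-cong-≗ λ i → ∑-const q (sum λ k → sum (t i k))) (scale (λ i → sum λ j → sum (t i j)))

  ∑³-only₁ : ∀ (f : Fin q → ℕ) → ∑³ (λ i j k → f i) ≡ q * (q * sum f)
  ∑³-only₁ f = trans (sum-cong-≗ λ i → trans (sum-cong-≗ {q} λ j → ∑-const q (f i)) (∑-const q (q * f i)))
    (trans (scale (λ i → q * f i)) (cong (q *_) (scale f)))

  ∑³-only₂ : ∀ (f : Fin q → ℕ) → ∑³ (λ i j k → f j) ≡ q * (q * sum f)
  ∑³-only₂ f = trans (∑-const q (sum λ j → sum {q} λ k → f j))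
    (cong (q *_) (trans (sum-cong-≗ λ j → ∑-const q (f j)) (scale f)))

  ∑⁴-+ : ∀ f g → ∑⁴ (λ i j k l → f i j k l + g i j k l) ≡ ∑⁴ f + ∑⁴ g
  ∑⁴-+ f g = trans (sum-cong-≗ λ i → trans (sum-cong-≗ λ j → trans (sum-cong-≗ λ k → ∑-distrib-+ (f i j k) (g i j k))
      (∑-distrib-+ (λ k → sum (f i j k)) (λ k → sum (g i j k))))
      (∑-distrib-+ (λ j → sum λ k → sum (f i j k)) (λ j → sum λ k → sum (g i j k))))
      (∑-distrib-+ (λ i → ∑³ (f i)) (λ i → ∑³ (g i)))

  ∑⁴-mono : ∀ {f g} → (∀ i j k l → f i j k l ≤ g i j k l) → ∑⁴ f ≤ ∑⁴ g
  ∑⁴-mono f≤g = ∑-mono λ i → ∑-mono λ j → ∑-mono λ k → ∑-mono λ l → f≤g i j k l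

  ∑⁴-one : ∑⁴ (λ _ _ _ _ → 1) ≡ q * (q * (q * q))
  ∑⁴-one = trans (∑⁴-drop₄ (λ _ _ _ → 1)) (cong (q *_) (trans (∑³-only₁ (λ _ → 1))
    (cong (λ t → q * (q * t)) (trans (∑-const q 1) (*-identityʳ q)))))

  -- Over all q⁴ quadruples, `e₁` and `e₂` contribute at most q⁴/4 each, and each of the five triple
  -- counts, blind to one coordinate, at most q · S. Hence q⁴ ≤ q⁴/2 + 5 · q · S.
  union-bound : (e₁ e₂ : Fin q → ℕ) (t₁ t₂ t₃ t₄ t₅ : Fin q → Fin q → Fin q → ℕ) (S : ℕ) →
    (∀ i j k l → 1 ≤ e₁ i + (e₂ j + (t₁ i j k + (t₂ i j l + (t₃ i k l + (t₄ i j k + t₅ i j l)))))) →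
    4 * sum e₁ ≤ q → 4 * sum e₂ ≤ q →
    ∑³ t₁ ≤ S → ∑³ t₂ ≤ S → ∑³ t₃ ≤ S → ∑³ t₄ ≤ S → ∑³ t₅ ≤ S → 0 < q →
    q * (q * q) ≤ 10 * S
  union-bound e₁ e₂ t₁ t₂ t₃ t₄ t₅ S cover e₁≤ e₂≤ t₁≤ t₂≤ t₃≤ t₄≤ t₅≤ 0<q =
    *-cancelˡ-≤ (2 * q) {{ℕ.>-nonZero (*-mono-≤ {1} {2} (s≤s z≤n) 0<q)}}
      (+-cancelˡ-≤ (q * (q * (q * q)) + q * (q * (q * q))) _ _ doubled)
    where
    open ≤-Reasoning
    total : q * (q * (q * q)) ≤ q * (q * (q * sum e₁)) + (q * (q * (q * sum e₂)) +
            (q * S + (q * S + (q * S + (q * S + q * S)))))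
    total = begin
      q * (q * (q * q))        ≡⟨ ∑⁴-one ⟨
      ∑⁴ (λ _ _ _ _ → 1)       ≤⟨ ∑⁴-mono cover ⟩
      ∑⁴ (λ i j k l → e₁ i + (e₂ j + (t₁ i j k + (t₂ i j l + (t₃ i k l + (t₄ i j k + t₅ i j l))))))
        ≡⟨ expand ⟩
      ∑⁴ (λ i j k l → e₁ i) + (∑⁴ (λ i j k l → e₂ j) + (∑⁴ (λ i j k l → t₁ i j k) + (∑⁴ (λ i j k l → t₂ i j l) +
        (∑⁴ (λ i j k l → t₃ i k l) + (∑⁴ (λ i j k l → t₄ i j k) + ∑⁴ (λ i j k l → t₅ i j l))))))
        ≤⟨ +-mono-≤ (≤-reflexive (trans (∑⁴-drop₄ (λ i j k → e₁ i)) (cong (q *_) (∑³-only₁ e₁))))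
          (+-mono-≤ (≤-reflexive (trans (∑⁴-drop₄ (λ i j k → e₂ j)) (cong (q *_) (∑³-only₂ e₂))))
          (+-mono-≤ (scaled (∑⁴-drop₄ t₁) t₁≤) (+-mono-≤ (scaled (∑⁴-drop₃ t₂) t₂≤) (+-mono-≤ (scaled (∑⁴-drop₂ t₃) t₃≤)
          (+-mono-≤ (scaled (∑⁴-drop₄ t₄) t₄≤) (scaled (∑⁴-drop₃ t₅) t₅≤)))))) ⟩
      q * (q * (q * sum e₁)) + (q * (q * (q * sum e₂)) + (q * S + (q * S + (q * S + (q * S + q * S))))) ∎
      where
      scaled : ∀ {x y} → x ≡ q * y → y ≤ S → x ≤ q * S
      scaled refl y≤S = *-monoʳ-≤ q y≤S
      expand = trans (∑⁴-+ (λ i j k l → e₁ i) (λ i j k l → e₂ j + (t₁ i j k + (t₂ i j l + (t₃ i k l + (t₄ i j k + t₅ i j l))))))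
        (cong (∑⁴ (λ i j k l → e₁ i) ℕ.+_) (trans (∑⁴-+ (λ i j k l → e₂ j) (λ i j k l → t₁ i j k + (t₂ i j l + (t₃ i k l + (t₄ i j k + t₅ i j l)))))
        (cong (∑⁴ (λ i j k l → e₂ j) ℕ.+_) (trans (∑⁴-+ (λ i j k l → t₁ i j k) (λ i j k l → t₂ i j l + (t₃ i k l + (t₄ i j k + t₅ i j l))))
        (cong (∑⁴ (λ i j k l → t₁ i j k) ℕ.+_) (trans (∑⁴-+ (λ i j k l → t₂ i j l) (λ i j k l → t₃ i k l + (t₄ i j k + t₅ i j l)))
        (cong (∑⁴ (λ i j k l → t₂ i j l) ℕ.+_) (trans (∑⁴-+ (λ i j k l → t₃ i k l) (λ i j k l → t₄ i j k + t₅ i j l))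
        (cong (∑⁴ (λ i j k l → t₃ i k l) ℕ.+_) (∑⁴-+ (λ i j k l → t₄ i j k) (λ i j k l → t₅ i j l)))))))))))
    Q = q * (q * (q * q))
    regroup₁ : ∀ q x y s → 4 * (q * (q * (q * x)) + (q * (q * (q * y)) + (q * s + (q * s + (q * s + (q * s + q * s))))))
               ≡ q * (q * (q * (4 * x))) + q * (q * (q * (4 * y))) + 2 * q * (10 * s)
    regroup₁ = solve-∀
    regroup₂ : ∀ q → q * (q * (q * q)) + q * (q * (q * q)) + 2 * q * (q * (q * q)) ≡ 4 * (q * (q * (q * q)))
    regroup₂ = solve-∀
    doubled : Q + Q + 2 * q * (q * (q * q)) ≤ Q + Q + 2 * q * (10 * S)
    doubled = begin
      Q + Q + 2 * q * (q * (q * q))   ≡⟨ regroup₂ q ⟩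
      4 * Q                           ≤⟨ *-monoʳ-≤ 4 total ⟩
      _                               ≡⟨ regroup₁ q (sum e₁) (sum e₂) S ⟩
      q * (q * (q * (4 * sum e₁))) + q * (q * (q * (4 * sum e₂))) + 2 * q * (10 * S)
        ≤⟨ +-monoˡ-≤ (2 * q * (10 * S)) (+-mono-≤ (cube e₁≤) (cube e₂≤)) ⟩
      Q + Q + 2 * q * (10 * S)        ∎
      where
      cube : ∀ {x} → x ≤ q → q * (q * (q * x)) ≤ Q
      cube x≤q = *-monoʳ-≤ q (*-monoʳ-≤ q (*-monoʳ-≤ q x≤q))

-- s, p, t carry the numerical constants: S is at least n³/s, the fraction of
-- unmodified triples is at least p/(p+1), and at most n/(t+1) vertices are exceptional.
few-modified : ∀ s p t c n r S W C → n ^ 3 ≤ s * S → S + 6 * W ≤ n ^ 3 → p * C ≤ suc p * W → r ^ 3 ≤ 6 * C →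
  n ≤ c + r → suc t * c ≤ n → 0 < n →
  suc t ^ 3 * suc p + s * p * t ^ 3 ≤ suc t ^ 3 * (suc p * s)
few-modified s p t c n r S W C n³≤sS S+6W≤ pC≤ r³≤6C n≤c+r c-small 0<n =
  -- Divided by (t + 1)³ (p + 1) s, the claim is 1/s + p/(p + 1) · (t/(t + 1))³ ≤ 1: modified and
  -- unmodified triples together do not exceed n³.
  *-cancelʳ-≤ _ _ (n ^ 3) {{m^n≢0 n 3 {{ℕ.>-nonZero 0<n}}}} (begin
    (suc t ^ 3 * suc p + s * p * t ^ 3) * n ^ 3              ≡⟨ regroup₁ (suc t ^ 3) (suc p) s p (t ^ 3) (n ^ 3) ⟩
    suc t ^ 3 * (suc p * n ^ 3) + s * p * (t ^ 3 * n ^ 3)    ≤⟨ +-monoʳ-≤ (suc t ^ 3 * (suc p * n ^ 3)) (*-monoʳ-≤ (s * p) cubes) ⟩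
    suc t ^ 3 * (suc p * n ^ 3) + s * p * (suc t ^ 3 * r ^ 3) ≡⟨ regroup₂ (suc t ^ 3) (suc p) s p (r ^ 3) (n ^ 3) ⟩
    suc t ^ 3 * (suc p * n ^ 3 + s * (p * r ^ 3))            ≤⟨ *-monoʳ-≤ (suc t ^ 3) main ⟩
    suc t ^ 3 * (suc p * (s * n ^ 3))                        ≡⟨ regroup₃ (suc t ^ 3) (suc p) s (n ^ 3) ⟩
    suc t ^ 3 * (suc p * s) * n ^ 3                          ∎)
  where
  open ≤-Reasoning
  regroup₁ : ∀ T P s p u x → (T * P + s * p * u) * x ≡ T * (P * x) + s * p * (u * x)
  regroup₁ = solve-∀
  regroup₂ : ∀ T P s p y x → T * (P * x) + s * p * (T * y) ≡ T * (P * x + s * (p * y))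
  regroup₂ = solve-∀
  regroup₃ : ∀ T P s x → T * (P * (s * x)) ≡ T * (P * s) * x
  regroup₃ = solve-∀
  regroup₄ : ∀ P s S W → P * (s * S) + s * (6 * (P * W)) ≡ P * (s * (S + 6 * W))
  regroup₄ = solve-∀
  regroup₅ : ∀ p C → p * (6 * C) ≡ 6 * (p * C)
  regroup₅ = solve-∀
  tn≤ : t * n ≤ suc t * r
  tn≤ = +-cancelˡ-≤ n _ _ (begin
    suc t * n              ≤⟨ *-monoʳ-≤ (suc t) n≤c+r ⟩
    suc t * (c + r)        ≡⟨ *-distribˡ-+ (suc t) c r ⟩
    suc t * c + suc t * r  ≤⟨ +-monoˡ-≤ (suc t * r) c-small ⟩
    n + suc t * r          ∎)
  cubes : t ^ 3 * n ^ 3 ≤ suc t ^ 3 * r ^ 3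
  cubes = begin
    t ^ 3 * n ^ 3      ≡⟨ ^-distribʳ-* 3 t n ⟨
    (t * n) ^ 3        ≤⟨ ^-monoˡ-≤ 3 tn≤ ⟩
    (suc t * r) ^ 3    ≡⟨ ^-distribʳ-* 3 (suc t) r ⟩
    suc t ^ 3 * r ^ 3  ∎
  main : suc p * n ^ 3 + s * (p * r ^ 3) ≤ suc p * (s * n ^ 3)
  main = begin
    suc p * n ^ 3 + s * (p * r ^ 3)                ≤⟨ +-mono-≤ (*-monoʳ-≤ (suc p) n³≤sS) (*-monoʳ-≤ s (*-monoʳ-≤ p r³≤6C)) ⟩
    suc p * (s * S) + s * (p * (6 * C))            ≡⟨ cong (λ x → suc p * (s * S) + s * x) (regroup₅ p C) ⟩
    suc p * (s * S) + s * (6 * (p * C))            ≤⟨ +-monoʳ-≤ (suc p * (s * S)) (*-monoʳ-≤ s (*-monoʳ-≤ 6 pC≤)) ⟩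
    suc p * (s * S) + s * (6 * (suc p * W))        ≡⟨ regroup₄ (suc p) s S W ⟩
    suc p * (s * (S + 6 * W))                      ≤⟨ *-monoʳ-≤ (suc p) (*-monoʳ-≤ s S+6W≤) ⟩
    suc p * (s * n ^ 3)                            ∎

-- Ordered arrangements of three-element sets

p₁ p₂ p₃ : Fin 6 → Fin 3
p₁ = lookup (0F ∷ 0F ∷ 1F ∷ 1F ∷ 2F ∷ 2F ∷ [])
p₂ = lookup (1F ∷ 2F ∷ 0F ∷ 2F ∷ 0F ∷ 1F ∷ [])
p₃ = lookup (2F ∷ 1F ∷ 2F ∷ 0F ∷ 1F ∷ 0F ∷ [])

-- The columns of `p₁`, `p₂`, `p₃` are the six permutations of three positions, and three
-- comparisons tell them apart. An arranged increasing triple therefore reveals its permutation, and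
-- then itself.
orderType : ∀ {m} → Fin m → Fin m → Fin m → Bool × Bool × Bool
orderType x y w = does (x Fin.<? y) , does (x Fin.<? w) , does (y Fin.<? w)

perm-distinct : ∀ π → Distinct (p₁ π) (p₂ π) (p₃ π)
perm-distinct = from-yes (FinP.all? λ π → distinct? (p₁ π) (p₂ π) (p₃ π))

perm-exhaustive : ∀ π i → i ≡ p₁ π ⊎ i ≡ p₂ π ⊎ i ≡ p₃ π
perm-exhaustive = from-yes (FinP.all? λ π → FinP.all? λ i →
  (i FinP.≟ p₁ π) ⊎-dec ((i FinP.≟ p₂ π) ⊎-dec (i FinP.≟ p₃ π)))

perm-orderType : ∀ π ρ → orderType (p₁ π) (p₂ π) (p₃ π) ≡ orderType (p₁ ρ) (p₂ ρ) (p₃ ρ) → π ≡ ρ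
perm-orderType = from-yes (FinP.all? λ π → FinP.all? λ ρ →
  (ProductP.≡-dec BoolP._≟_ (ProductP.≡-dec BoolP._≟_ BoolP._≟_) (orderType (p₁ π) (p₂ π) (p₃ π)) (orderType (p₁ ρ) (p₂ ρ) (p₃ ρ)))
  →-dec (π FinP.≟ ρ))

lookup-ext : ∀ {A : Set} {k} {v w : Vec A k} → (∀ i → lookup v i ≡ lookup w i) → v ≡ w
lookup-ext {v = v} {w} eq =
  trans (sym (VecP.tabulate∘lookup v)) (trans (VecP.tabulate-cong eq) (VecP.tabulate∘lookup w))

module _ {m : ℕ} where

  orderType-lookup : ∀ (w : Vec (Fin m) 3) → StrictIncr w → ∀ a b c →
    orderType (lookup w a) (lookup w b) (lookup w c) ≡ orderType a b c
  orderType-lookup w inc a b c = cong₂ _,_ (same a b) (cong₂ _,_ (same a c) (same b c))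
    where
    reflects : ∀ a b → lookup w a Fin.< lookup w b → a Fin.< b
    reflects a b lt with FinP.<-cmp a b
    ... | tri< a<b _ _  = a<b
    ... | tri≈ _ refl _ = ⊥-elim (FinP.<-irrefl refl lt)
    ... | tri> _ _ b<a  = ⊥-elim (FinP.<-asym lt (inc b a b<a))
    same : ∀ a b → does (lookup w a Fin.<? lookup w b) ≡ does (a Fin.<? b)
    same a b = does-⇔ (mk⇔ (reflects a b) (inc a b)) (lookup w a Fin.<? lookup w b) (a Fin.<? b)

  arrangement-injective : ∀ {v w : Vec (Fin m) 3} → StrictIncr v → StrictIncr w → ∀ π ρ →
    lookup v (p₁ π) ≡ lookup w (p₁ ρ) → lookup v (p₂ π) ≡ lookup w (p₂ ρ) → lookup v (p₃ π) ≡ lookup w (p₃ ρ) →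
    π ≡ ρ × v ≡ w
  arrangement-injective {v} {w} v-inc w-inc π ρ e₁ e₂ e₃
    with refl ← perm-orderType π ρ (trans (sym (orderType-lookup v v-inc _ _ _))
           (trans (cong₂ (λ x (y , z) → orderType x y z) e₁ (cong₂ _,_ e₂ e₃)) (orderType-lookup w w-inc _ _ _)))
    = refl , lookup-ext agree
    where
    agree : ∀ i → lookup v i ≡ lookup w i
    agree i with perm-exhaustive π i
    ... | inj₁ refl        = e₁
    ... | inj₂ (inj₁ refl) = e₂
    ... | inj₂ (inj₂ refl) = e₃

all-lookup : ∀ {A : Set} {P : A → Set} {xs : List A} → All P xs → ∀ i → P (List.lookup xs i)
all-lookup {xs = xs} pxs i = All.lookup pxs (∈-lookup {xs = xs} i)

lookup-injective : ∀ {A : Set} {xs : List A} → Unique xs → Injective _≡_ _≡_ (List.lookup xs)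
lookup-injective (x∉ ∷ xs!) {zero}  {zero}  _  = refl
lookup-injective (x∉ ∷ xs!) {zero}  {suc j} eq = ⊥-elim (all-lookup x∉ j eq)
lookup-injective (x∉ ∷ xs!) {suc i} {zero}  eq = ⊥-elim (all-lookup x∉ i (sym eq))
lookup-injective (x∉ ∷ xs!) {suc i} {suc j} eq = cong suc (lookup-injective xs! eq)

-- Every increasing triple in the list accounts for six ordered triples where t vanishes.
∑³+6*length≤n³ : ∀ {m n} (emb : Fin m → Fin n) → Injective _≡_ _≡_ emb →
  (ws : List (Vec (Fin m) 3)) → Unique ws → All StrictIncr ws →
  (t : Fin n → Fin n → Fin n → ℕ) → (∀ x y w → t x y w ≤ 1) →
  All (λ w → ∀ π → t (emb (lookup w (p₁ π))) (emb (lookup w (p₂ π))) (emb (lookup w (p₃ π))) ≡ 0) ws →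
  ∑³ t + 6 * length ws ≤ n * (n * n)
∑³+6*length≤n³ {m} {n} emb emb-inj ws ws! ws-inc t t≤1 vanish =
  subst (λ s → s + 6 * length ws ≤ n * (n * n)) (∑³-combine t flat flat-combine)
    (∑+zeros place place-injective flat (λ j → t≤1 _ _ _)
      (λ i → trans (flat-combine _ _ _) (all-lookup vanish (remainder {6} (length ws) i) (quotient (length ws) i))))
  where
  f₁ f₂ f₃ : Fin (n * (n * n)) → Fin n
  f₁ s = quotient (n * n) s
  f₂ s = quotient {n} n (remainder {n} (n * n) s)
  f₃ s = remainder {n} n (remainder {n} (n * n) s)
  flat : Fin (n * (n * n)) → ℕ
  flat s = t (f₁ s) (f₂ s) (f₃ s)
  flat-combine : ∀ x y w → flat (combine x (combine y w)) ≡ t x y w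
  flat-combine x y w = trans
    (cong₂ (λ a b → t a (quotient n b) (remainder {n} n b)) (quotient-combine x (combine y w)) (remainder-combine x (combine y w)))
    (cong₂ (t x) (quotient-combine y w) (remainder-combine y w))
  at : Fin (6 * length ws) → Vec (Fin m) 3
  at i = List.lookup ws (remainder {6} (length ws) i)
  perm : Fin (6 * length ws) → Fin 6
  perm i = quotient (length ws) i
  place : Fin (6 * length ws) → Fin (n * (n * n))
  place i = combine (emb (lookup (at i) (p₁ (perm i)))) (combine (emb (lookup (at i) (p₂ (perm i)))) (emb (lookup (at i) (p₃ (perm i)))))
  place-injective : Injective _≡_ _≡_ place
  place-injective {i} {j} eq =
    let e₁ , e = FinP.combine-injective _ _ _ _ eq
        e₂ , e₃ = FinP.combine-injective _ _ _ _ e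
        π≡ , w≡ = arrangement-injective (all-lookup ws-inc _) (all-lookup ws-inc _) (perm i) (perm j)
                    (emb-inj e₁) (emb-inj e₂) (emb-inj e₃)
    in remQuot-injective {6} (length ws) π≡ (lookup-injective ws! w≡)

cube≤6*C : ∀ m → (m ∸ 3) ^ 3 ≤ 6 * (m C 3)
cube≤6*C 0 = z≤n
cube≤6*C 1 = z≤n
cube≤6*C 2 = z≤n
cube≤6*C (suc (suc (suc r))) = ≤-trans (^≤fall r 3) (≤-reflexive (sym (!*C≡fall (3 + r) 3)))

bijection-bound : ∀ {a m n} → (Fin a ⊎ Fin m) ⤖ Fin n → n ≤ a + m
bijection-bound {a} {m} {n} β = FinP.injective⇒≤ {f = λ x → Fin.join a m (inverse x)} λ {x} {y} eq →
  trans (sym (is-inverse x)) (trans (cong (⤖-to β)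
    (trans (sym (FinP.splitAt-join a m (inverse x))) (trans (cong (Fin.splitAt a) eq) (FinP.splitAt-join a m (inverse y))))) (is-inverse y))
  where
  inverse : Fin n → Fin a ⊎ Fin m
  inverse x = proj₁ (Bijection.surjective β x)
  is-inverse : ∀ x → ⤖-to β (inverse x) ≡ x
  is-inverse x = proj₂ (Bijection.surjective β x) refl

-- Proves a union bound term by term: either this indicator already supplies the 1, or the negation
-- becomes a hypothesis for the remaining terms.
cover : ∀ {A : Set} (A? : Dec A) {rest} → (¬ A → 1 ≤ rest) → 1 ≤ 𝟙 A? + rest
cover (yes _) _  = s≤s z≤n
cover (no ¬a) le = le ¬a

cover-last : ∀ {A : Set} (A? : Dec A) → (¬ A → ⊥) → 1 ≤ 𝟙 A?
cover-last (yes _) _   = s≤s z≤n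
cover-last (no ¬a) ¬¬a = ⊥-elim (¬¬a ¬a)

-- Parts (b) and (c): too many triples are modified

module NotRepairable (K : Palette) (c₀ c₁ : Col K 3) (c₀≢c₁ : c₀ ≢ c₁)
                     (single-above : ∀ j → card K (4 + j) ≡ 1) (order≡3 : order K ≡ 3)
                     (p t : ℕ) (gap : suc t ^ 3 * (suc p * 270) < suc t ^ 3 * suc p + 270 * p * t ^ 3) where

  open OrderThree K c₀ c₁ c₀≢c₁ single-above

  module Count {L n q a m : ℕ} (𝓒 : Coding L (4 * suc a) n q) (n≡3q : n ≡ 3 * q) (0<q : 0 < q)
               (R : Rule K a) (β : (Fin a ⊎ Fin m) ⤖ Fin n) where

    open Coding 𝓒
    open Graph 𝓒
    open Coded 𝓒
    open Repaired R β
    open Flip o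

    Grest : Hyp K (Fin m)
    Grest = pull inj₂ (λ { refl → refl }) (pull (⤖-to β) (⤖-injective β) hypergraph)

    bad : Fin n → Fin n → Fin n → ℕ
    bad x y w = 𝟙 (¬? (unmodified? x y w))

    usedness : Fin 3 → Fin q → ℕ
    usedness c i = 𝟙 (used? (typ (member c i)))

    -- A meets at most a of the `4 * suc a` types, and the types are equidistributed in each class.
    few-used : ∀ c → 4 * sum (usedness c) ≤ q
    few-used c = *-cancelˡ-≤ (suc a) (begin
      suc a * (4 * E)                    ≡⟨ regroup (suc a) E ⟩
      4 * suc a * E                      ≡⟨ typ-equidistributed c (λ k → 𝟙 (used? k)) ⟩
      q * sum (λ k → 𝟙 (used? k))        ≤⟨ *-monoʳ-≤ q (∑-image (λ i → typ (⤖-to β (inj₁ i)))) ⟩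
      q * a                              ≤⟨ *-monoʳ-≤ q (n≤1+n a) ⟩
      q * suc a                          ≡⟨ *-comm q (suc a) ⟩
      suc a * q                          ∎)
      where
      open ≤-Reasoning
      E = sum (usedness c)
      regroup : ∀ a e → a * (4 * e) ≡ 4 * a * e
      regroup = solve-∀

    -- 270 = 10 · 3³, since n = 3q.
    many-bad : Good TG → n ^ 3 ≤ 270 * ∑³ bad
    many-bad TG-good = begin
      n ^ 3                        ≡⟨ cong (_^ 3) n≡3q ⟩
      (3 * q) ^ 3                  ≡⟨ ^-distribʳ-* 3 3 q ⟩
      27 * q ^ 3                   ≡⟨ cong (λ t → 27 * (q * (q * t))) (*-identityʳ q) ⟩
      27 * (q * (q * q))           ≤⟨ *-monoʳ-≤ 27 q³≤10S ⟩
      27 * (10 * ∑³ bad)           ≡⟨ *-assoc 27 10 (∑³ bad) ⟨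
      270 * ∑³ bad                 ∎
      where
      open ≤-Reasoning
      z = member Z
      v = member V
      y = member Y
      σv = λ j → σ (v j)
      σv-injective : Injective _≡_ _≡_ σv
      σv-injective eq = member-injective V (σ-injective eq)
      stable : ∀ {x y w} → ¬ ¬ Unmodified x y w → Unmodified x y w
      stable = decidable-stable (unmodified? _ _ _)
      restricted : ∀ (f g h : Fin q → Fin n) → Injective _≡_ _≡_ f → Injective _≡_ _≡_ g → Injective _≡_ _≡_ h →
        ∑³ (λ i j k → bad (f i) (g j) (h k)) ≤ ∑³ bad
      restricted f g h f-inj g-inj h-inj = ∑³-injective f g h f-inj g-inj h-inj bad
      q³≤10S : q * (q * q) ≤ 10 * ∑³ bad
      q³≤10S = union-bound (usedness Z) (usedness V)
        (λ i j k → bad (z i) (v j) (y k)) (λ i j l → bad (z i) (v j) (y l)) (λ i k l → bad (z i) (y k) (y l))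
        (λ i j k → bad (z i) (σv j) (y k)) (λ i j l → bad (z i) (σv j) (y l)) (∑³ bad)
        (λ i j k l →
          cover (used? (typ (z i))) λ z-unused →
          cover (used? (typ (v j))) λ v-unused →
          cover (¬? (unmodified? (z i) (v j) (y k))) λ zvy →
          cover (¬? (unmodified? (z i) (v j) (y l))) λ zvy′ →
          cover (¬? (unmodified? (z i) (y k) (y l))) λ zyy′ →
          cover (¬? (unmodified? (z i) (σv j) (y k))) λ zσvy →
          cover-last (¬? (unmodified? (z i) (σv j) (y l))) λ zσvy′ →
          modified TG-good (cls-member Z i) (cls-member V j) (cls-member Y k) (cls-member Y l)
            (o-unused z-unused) (o-unused v-unused)
            (stable zvy) (stable zvy′) (stable zyy′) (stable zσvy) (stable zσvy′))
        (few-used Z) (few-used V)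
        (restricted z v y (member-injective Z) (member-injective V) (member-injective Y))
        (restricted z v y (member-injective Z) (member-injective V) (member-injective Y))
        (restricted z y y (member-injective Z) (member-injective Y) (member-injective Y))
        (restricted z σv y (member-injective Z) σv-injective (member-injective Y))
        (restricted z σv y (member-injective Z) σv-injective (member-injective Y))
        0<q

    unmodified-restriction : ∀ (w : Vec (Fin m) 3) (inc : StrictIncr w) → restrict TG w inc ≈ restrict Grest w inc →
      ∀ π → bad (emb (lookup w (p₁ π))) (emb (lookup w (p₂ π))) (emb (lookup w (p₃ π))) ≡ 0
    unmodified-restriction w inc same π = 𝟙-no (¬? (unmodified? _ _ _)) λ modif → modif
      (x , y , u , refl , refl , refl , (begin
        edge TG x y u                                  ≡⟨ edge-pull (lookup w) (incr-inj w inc) TG (p₁ π) (p₂ π) (p₃ π) ⟨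
        edge (restrict TG w inc) (p₁ π) (p₂ π) (p₃ π)  ≡⟨ edge-resp {G = restrict TG w inc} {restrict Grest w inc} same (p₁ π) (p₂ π) (p₃ π) ⟩
        edge (restrict Grest w inc) (p₁ π) (p₂ π) (p₃ π)
          ≡⟨ edge-pull (lookup w) (incr-inj w inc) Grest (p₁ π) (p₂ π) (p₃ π) ⟩
        edge Grest x y u                               ≡⟨ edge-resp {G = Grest} {pull emb emb-injective hypergraph} Grest≈ x y u ⟩
        edge (pull emb emb-injective hypergraph) x y u ≡⟨ edge-pull emb emb-injective hypergraph x y u ⟩
        edge hypergraph (emb x) (emb y) (emb u)        ≡⟨ edge-hypergraph (distinct-map emb∘w-injective (perm-distinct π)) ⟩
        just (h (emb x) (emb y) (emb u))               ∎))
      where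
      open ≡-Reasoning
      x = lookup w (p₁ π)
      y = lookup w (p₂ π)
      u = lookup w (p₃ π)
      Grest≈ : Grest ≈ pull emb emb-injective hypergraph
      Grest≈ j v p = col-cong hypergraph _ (map-inj emb emb-injective v p) (sym (VecP.map-∘ (⤖-to β) inj₂ v))
      emb∘w-injective : Injective _≡_ _≡_ (λ i → emb (lookup w i))
      emb∘w-injective eq = incr-inj w inc (emb-injective eq)

    -- The a + 3 exceptional vertices are those of A and the three lost in `cube≤6*C`. The index `k`
    -- stands for `order K`, which does not reduce to 3 for an abstract palette.
    not-repaired : Good TG → suc t * (a + 3) ≤ n → ∀ {k} → k ≡ 3 →
      ¬ AtLeastFraction (1ℚ ℚ.- (+ 1 ℚ./ suc p)) m k (λ w inc → restrict TG w inc ≈ restrict Grest w inc)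
    not-repaired TG-good large refl (ws , ws! , same , fraction) = <⇒≱ gap
      (few-modified 270 p t (a + 3) n (m ∸ 3) (∑³ bad) (length ws) (m C 3)
        (many-bad TG-good)
        (subst (∑³ bad + 6 * length ws ≤_) (cong (λ t → n * (n * t)) (sym (*-identityʳ n)))
          (∑³+6*length≤n³ emb emb-injective ws ws! (All.map proj₁ same) bad
            (λ x y w → 𝟙≤1 (¬? (unmodified? x y w)))
            (All.map (λ {w} (inc , eq) → unmodified-restriction w inc eq) same)))
        (fraction-elim p (m C 3) (length ws) fraction)
        (cube≤6*C m)
        (≤-trans (bijection-bound β) (≤-trans (+-monoʳ-≤ a (m≤n+m∸n m 3)) (≤-reflexive (sym (+-assoc a 3 (m ∸ 3))))))
        large
        (≤-trans (*-mono-≤ {1} {3} (s≤s z≤n) 0<q) (≤-reflexive (sym n≡3q))))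

  module _ (a L : ℕ) where

    rest size : ℕ
    rest = 4 * suc a * 2 ^ (4 * suc a)
    size = L * (3 * rest)

    counterexample : Hyp K (Fin size)
    counterexample = Coded.hypergraph (coding L (4 * suc a))

    0<rest : 0 < rest
    0<rest = *-mono-≤ {1} {4 * suc a} {1} (s≤s z≤n) (m^n>0 2 (4 * suc a))

    L≤size : L ≤ size
    L≤size = m≤m*n L (3 * rest) {{ℕ.>-nonZero (*-mono-≤ {1} {3} (s≤s z≤n) 0<rest)}}

    transversal∈goodProperty : ∀ {N} (w : Vec (Fin size) N) inc → Transversal {L} {3 * rest} w →
      mem goodProperty N (restrict counterexample w inc) ≡ true
    transversal∈goodProperty w inc tr = dec-true (good? (restrict counterexample w inc))
      (Coded.transversal-good (coding L (4 * suc a)) (lookup w) (incr-inj w inc) tr)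

    size≡3q : size ≡ 3 * (L * rest)
    size≡3q = x∙3y L rest
      where
      x∙3y : ∀ x y → x * (3 * y) ≡ 3 * (x * y)
      x∙3y = solve-∀

  mostly-good : ∀ a N δ → a + order K ≤ N → 0ℚ ℚ.< δ → Σ ℕ λ L →
    0 < L × N ≤ size a L × suc t * (a + 3) ≤ size a L ×
    AtLeastFraction (1ℚ ℚ.- δ) (size a L) N (λ w inc → mem goodProperty N (restrict (counterexample a L) w inc) ≡ true)
  mostly-good a N δ a+k≤N 0<δ = L , 0<L , ≤-trans N≤ (≤-trans N²≤L (L≤size a L)) ,
    ≤-trans (*-monoʳ-≤ (suc t) (≤-trans a+3≤N N≤)) (L≤size a L) ,
    proj₂ (mostly-transversal δ 0<δ) N L (3 * rest a L) N²≤L 0<L _ (λ w inc tr → transversal∈goodProperty a L w inc tr)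
    where
    u L : ℕ
    u = proj₁ (mostly-transversal δ 0<δ)
    -- The factor `suc u * (N * N)` makes transversals typical; the factor `suc t` makes a + 3
    -- vertices a negligible part of the whole.
    L = suc t * (suc u * (N * N))
    a+3≤N : a + 3 ≤ N
    a+3≤N = subst (λ o → a + o ≤ N) order≡3 a+k≤N
    0<N : 0 < N
    0<N = ≤-trans (s≤s z≤n) (≤-trans (m≤n+m 3 a) a+3≤N)
    N≤ : N ≤ suc u * (N * N)
    N≤ = ≤-trans (m≤m*n N N {{ℕ.>-nonZero 0<N}}) (m≤m+n (N * N) (u * (N * N)))
    N²≤L : suc u * (N * N) ≤ L
    N²≤L = m≤n*m (suc u * (N * N)) (suc t)
    0<L : 0 < L
    0<L = ≤-trans 0<N (≤-trans N≤ N²≤L)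

  not-repairable : ¬ WeaklyLocallyRepairable goodProperty
  not-repairable repair =
    case repair (+ 1 ℚ./ suc p) (ℚP.positive⁻¹ (+ 1 ℚ./ suc p) {{ℚP.normalize-pos 1 (suc p)}}) of
      λ (a , N , δ , a+k≤N , 0<δ , fix) →
    case mostly-good a N δ a+k≤N 0<δ of
      λ (L , 0<L , N≤n , large , most) →
    case fix (size a L) N≤n (counterexample a L) most of
      λ (R , m , β , TG∈P , unmodified) →
    Count.not-repaired (coding L (4 * suc a)) (size≡3q a L) (*-mono-≤ 0<L (0<rest a L)) R β
      (does⇒true (good? _) TG∈P) large order≡3 unmodified

theorem1p9 : (Σ (Property (binaryAt 2)) λ P → ¬ WeaklyLocallyRepairable P)
    × (Σ (Property pt0123) λ P → UndirectedProperty P × ¬ WeaklyLocallyRepairable P)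
    × (Σ (Property (binaryAt 3)) λ P → UndirectedProperty P × ¬ WeaklyLocallyRepairable P)
theorem1p9 =
  (Tournaments.tournaments , Tournaments.not-repairable) ,
  (B.goodProperty , (λ n G G∈ → B.good⇒undirected G (does⇒true (B.good? G) G∈)) ,
    NotRepairable.not-repairable pt0123 zero (suc zero) (λ ()) (λ _ → refl) refl 999 2999 gap) ,
  (C.goodProperty , (λ n G G∈ → C.good⇒undirected G (does⇒true (C.good? G) G∈)) ,
    NotRepairable.not-repairable (binaryAt 3) zero (suc zero) (λ ()) (λ _ → refl) refl 999 2999 gap)
  where
  -- Here ε = 1/1000 and at most n/3000 vertices are exceptional, so less than 1/1000 + 3/3000 =
  -- 1/500 of the triples would be modified, against the required 1/270.
  gap : 3000 ^ 3 * (1000 * 270) < 3000 ^ 3 * 1000 + 270 * 999 * 2999 ^ 3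
  gap = ≤ᵇ⇒≤ _ _ tt
  module B = OrderThree pt0123 zero (suc zero) (λ ()) (λ _ → refl)
  module C = OrderThree (binaryAt 3) zero (suc zero) (λ ()) (λ _ → refl)
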